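{- For every positive integer $n$, the inspection number of the triangular grid graph $T_n$ satisfies \[ \frac{n}{\sqrt{2}}<\mathrm{In}(T_n)\le \left\lceil\frac{3n}{4}\right\rceil+2 . \]
   Context: The triangular grid graph $T_n$ has vertex set $\{(v_1,v_2)\in\mathbb{Z}_{\ge 0}^2 : v_1+v_2\le n\}$, and two vertices are adjacent iff they are of the form $(a,b),(a+1,b)$, or $(a,b),(a,b+1)$, or $(a+1,b),(a,b+1)$. Zero-Visibility $k$-Search game on a graph $G$: an invisible intruder occupies a vertex; in each turn the searcher examines a set of at most $k$ vertices, and the intruder is caught if it is on an examined vertex; between consecutive examinations the intruder may stay at its vertex or move to an adjacent vertex, and the searcher never has any information about the intruder's position. A winning strategy is a finite sequence $S_1,\dots,S_T$ of vertex sets with $|S_i|\le k$ such that there is no sequence of vertices $x_1,\dots,x_T$ with $x_i\notin S_i$ for all $i$ and, for each $i<T$, $x_{i+1}=x_i$ or $x_{i+1}$ adjacent to $x_i$ (i.e. the intruder is caught no matter how it moves). The inspection number $\mathrm{In}(G)$ is the minimum $k$ for which a winning strategy exists. -}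

module Defs where

open import Data.Nat using (ℕ; zero; suc; _+_; _*_; _≤_; _<_; _/_)
open import Data.Product using (Σ; ∃; _×_; _,_)
open import Data.Sum using (_⊎_)
open import Data.List using (List; []; _∷_; length)
open import Data.List.Relation.Unary.All using (All)
open import Data.List.Membership.Propositional using (_∉_)
open import Relation.Binary.PropositionalEquality using (_≡_)
open import Relation.Nullary using (¬_)
open import Data.Unit using (⊤)

Pt : Set
Pt = ℕ × ℕ

InT : ℕ → Pt → Set
InT n (a , b) = a + b ≤ n

data Adj : Pt → Pt → Set where
  right  : ∀ a b → Adj (a , b) (suc a , b)
  left   : ∀ a b → Adj (suc a , b) (a , b)
  up     : ∀ a b → Adj (a , b) (a , suc b)
  down   : ∀ a b → Adj (a , suc b) (a , b)
  diagUL : ∀ a b → Adj (suc a , b) (a , suc b)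
  diagDR : ∀ a b → Adj (a , suc b) (suc a , b)

StayOrMove : Pt → Pt → Set
StayOrMove x y = x ≡ y ⊎ Adj x y

-- Evades n x (S₁ ∷ … ∷ S_T): there is an intruder walk x = x₁, x₂, …, x_T
-- in T_n with xᵢ ∉ Sᵢ for all i and each step a stay or an edge.
Evades : ℕ → Pt → List (List Pt) → Set
Evades n x [] = ⊤
Evades n x (S ∷ []) = x ∉ S
Evades n x (S ∷ S′ ∷ Ss) =
  x ∉ S × ∃ λ y → InT n y × StayOrMove x y × Evades n y (S′ ∷ Ss)

Escapes : ℕ → List (List Pt) → Set
Escapes n Ss = ∃ λ x → InT n x × Evades n x Ss

-- A winning strategy for the zero-visibility k-search game on T_n:
-- a finite sequence of examined sets, each a set of at most k vertices of T_n
-- (represented as a list of vertices of length ≤ k), such that no intruder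
-- walk escapes.
WinningStrategy : ℕ → ℕ → List (List Pt) → Set
WinningStrategy n k Ss =
  All (λ S → length S ≤ k × All (InT n) S) Ss × ¬ Escapes n Ss

HasWinningStrategy : ℕ → ℕ → Set
HasWinningStrategy n k = ∃ λ Ss → WinningStrategy n k Ss

IsInspectionNumber : ℕ → ℕ → Set
IsInspectionNumber n k =
  HasWinningStrategy n k × (∀ j → HasWinningStrategy n j → k ≤ j)

ceil3n/4 : ℕ → ℕ
ceil3n/4 n = (3 * n + 3) / 4

{-# OPTIONS --safe #-}
-- Lower bound.  Write x_a for the number of points of B in column a, which has
-- ℓ_a = n + 1 - a points, and c_a for the number of points of N[B] \ B there.
-- With F = ∑ c_a the number of new points, telescoping the x_a (or the
-- deficits ℓ_a - x_a) along the columns gives 2|B| ≤ F² or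
-- 2|T_n \ B| ≤ F(F + 1).  If 2k² ≤ n², then |B| ≥ k(k + 1)/2 + 1 forces
-- |N[B]| ≥ k(k + 1)/2 + 1 + k, so k examined vertices can never push the number of possible
-- positions of the intruder below k(k + 1)/2 + 1 + k.
--
-- Upper bound.  Put h = ⌈3n/4⌉ and c = n - h, so 3c ≤ h.  With h + 2 searchers,
-- sweep by diagonals until only a + b ≥ h is contaminated; going on would need a
-- frontier of more than h + 2.  Instead trade the clean triangle for the columns
-- a < c: the diagonal frontier left of column c advances to the hypotenuse while
-- the right part of the triangle is surrendered.  Recontamination moves at unit
-- speed, so the c + 1 turns this takes never need more than 3c + 2 searchers.
-- The other columns have at most h + 1 points and can be swept one by one.
--
-- The minimum exists because winning with k searchers is decidable: the sets of
-- possible positions form a finite state space.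
module Submission where

open import Defs
open import Data.Bool using (true; false; if_then_else_)
open import Data.Empty using (⊥-elim)
open import Data.List using (List; []; _∷_; _++_; length; filter; map; upTo; cartesianProduct; cartesianProductWith)
open import Data.List.Membership.Propositional using (_∈_; _∉_; find; lose)
open import Data.List.Membership.Propositional.Properties
  using (∈-filter⁺; ∈-filter⁻; ∈-upTo⁺; ∈-cartesianProduct⁺; ∈-cartesianProductWith⁺;
         ∈-cartesianProductWith⁻; ∈-++⁺ˡ; ∈-++⁺ʳ; ∈-map⁺)
open import Data.List.Properties using (length-filter; length-++; length-map; length-upTo)
open import Data.List.Relation.Unary.All as All using (All; []; _∷_; all?)
open import Data.List.Relation.Unary.All.Properties using (¬All⇒Any¬)
open import Data.List.Relation.Unary.Any as Any using (Any; here; there; any?)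
open import Data.Nat
open import Data.Nat.DivMod using (m≡m%n+[m/n]*n; m%n<n; m<n*o⇒m/o<n)
open import Data.Nat.Properties
open import Data.Nat.Tactic.RingSolver using (solve-∀)
open import Data.Product using (∃; _×_; _,_; proj₁; proj₂)
open import Data.Product.Properties using (≡-dec)
open import Data.Sum using (_⊎_; inj₁; inj₂; [_,_]′)
open import Data.Unit using (⊤; tt)
open import Function using (_∘_; case_of_; id)
open import Relation.Binary.Definitions using (tri<; tri≈; tri>)
open import Relation.Binary.PropositionalEquality
open import Relation.Nullary using (¬_; Dec; yes; no)
open import Relation.Nullary.Decidable using (does; _×-dec_; _⊎-dec_; _→-dec_; ¬?; map′)
open import Relation.Unary using (Decidable)

open import Data.List.Membership.DecPropositional (≡-dec _≟_ _≟_) using (_∈?_)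

-- Finite sums and bounded search on the natural numbers.

∑ : ℕ → (ℕ → ℕ) → ℕ
∑ zero f = 0
∑ (suc n) f = ∑ n f + f n

∑-mono : ∀ n {f g} → (∀ i → i < n → f i ≤ g i) → ∑ n f ≤ ∑ n g
∑-mono zero h = z≤n
∑-mono (suc n) h = +-mono-≤ (∑-mono n (λ i i<n → h i (m≤n⇒m≤1+n i<n))) (h n ≤-refl)

∑-cong : ∀ n {f g} → (∀ i → i < n → f i ≡ g i) → ∑ n f ≡ ∑ n g
∑-cong zero h = refl
∑-cong (suc n) h = cong₂ _+_ (∑-cong n (λ i i<n → h i (m≤n⇒m≤1+n i<n))) (h n ≤-refl)

∑-+ : ∀ n f g → ∑ n (λ i → f i + g i) ≡ ∑ n f + ∑ n g
∑-+ zero f g = refl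
∑-+ (suc n) f g rewrite ∑-+ n f g = eq (∑ n f) (∑ n g) (f n) (g n)
  where
  eq : ∀ p q r s → p + q + (r + s) ≡ p + r + (q + s)
  eq = solve-∀

∑-mono-length : ∀ {m n} f → m ≤ n → ∑ m f ≤ ∑ n f
∑-mono-length {m} f m≤n = go (≤⇒≤′ m≤n)
  where
  go : ∀ {n} → m ≤′ n → ∑ m f ≤ ∑ n f
  go ≤′-refl = ≤-refl
  go (≤′-step p) = ≤-trans (go p) (m≤m+n _ _)

∑-positive : ∀ n f → 0 < ∑ n f → ∃ λ i → i < n × 0 < f i
∑-positive (suc n) f pos with f n in eq
... | suc _ = n , ≤-refl , subst (0 <_) (sym eq) z<s
... | zero with i , i<n , 0<fi ← ∑-positive n f (subst (0 <_) (+-identityʳ _) pos) =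
  i , m≤n⇒m≤1+n i<n , 0<fi

∑-single : ∀ n k {f g} → (∀ i → i ≢ k → f i ≤ g i) → f k ≤ suc (g k) → ∑ n f ≤ suc (∑ n g)
∑-single zero k h hk = z≤n
∑-single (suc n) k {f} {g} h hk with n ≟ k
... | yes refl = ≤-trans (+-mono-≤ (∑-mono n (λ i i<n → h i (<⇒≢ i<n))) hk) (≤-reflexive (+-suc _ _))
... | no n≢k = +-mono-≤ (∑-single n k h hk) (h n n≢k)

Least : (ℕ → Set) → ℕ → Set
Least P k = P k × (∀ j → P j → k ≤ j)

-- `n` bounds the search only: the witness is a minimum over all naturals, and the result does not
-- record that it lies below `n`.
least : {P : ℕ → Set} → Decidable P → ∀ n → (∃ (Least P)) ⊎ (∀ j → j < n → ¬ P j)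
least P? zero = inj₂ (λ j ())
least P? (suc n) with least P? n
... | inj₁ l = inj₁ l
... | inj₂ none with P? n
...   | yes p = inj₁ (n , p , λ j pj → ≮⇒≥ (λ j<n → none j j<n pj))
...   | no ¬p = inj₂ λ j j<1+n pj → case m≤n⇒m<n∨m≡n (≤-pred j<1+n) of λ where
          (inj₁ j<n) → none j j<n pj
          (inj₂ refl) → ¬p pj

greatest-below : {P : ℕ → Set} → Decidable P → ∀ n →
  (∃ λ k → k < n × P k × (∀ j → k < j → j < n → ¬ P j)) ⊎ (∀ j → j < n → ¬ P j)
greatest-below P? zero = inj₂ (λ j ())
greatest-below P? (suc n) with P? n
... | yes p = inj₁ (n , ≤-refl , p , λ j n<j j<1+n → ⊥-elim (<-irrefl refl (<-≤-trans n<j (≤-pred j<1+n))))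
... | no ¬p with greatest-below P? n
...   | inj₁ (k , k<n , pk , gt) = inj₁ (k , m≤n⇒m≤1+n k<n , pk , λ j k<j j<1+n pj →
          case m≤n⇒m<n∨m≡n (≤-pred j<1+n) of λ where
            (inj₁ j<n) → gt j k<j j<n pj
            (inj₂ refl) → ¬p pj)
...   | inj₂ none = inj₂ λ j j<1+n pj → case m≤n⇒m<n∨m≡n (≤-pred j<1+n) of λ where
            (inj₁ j<n) → none j j<n pj
            (inj₂ refl) → ¬p pj

-- The isoperimetric inequality for column profiles.

≤-by : ∀ {a b} d → b ≡ a + d → a ≤ b
≤-by d eq = ≤-trans (m≤m+n _ d) (≤-reflexive (sym eq))

-- Column a of T_n has x a points of B, z a further points, and c a points of N[B] outside B.
record Profile (n : ℕ) : Set where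
  field
    x z c : ℕ → ℕ
    last   : x n + z n ≡ 1
    next   : ∀ a → a < n → x a + z a ≡ suc (x (suc a) + z (suc a))
    c≤z    : ∀ a → a ≤ n → c a ≤ z a
    mixed  : ∀ a → a ≤ n → x a ≡ 0 ⊎ z a ≡ 0 ⊎ 1 ≤ c a
    onward : ∀ a → a < n → z (suc a) ≤ c (suc a) ⊎ x a ≤ x (suc a) + c (suc a)
    back   : ∀ a → a < n → x (suc a) ≡ 0 ⊎ suc (x (suc a)) ≤ x a + c a

module _ {n : ℕ} (P : Profile n) where
  open Profile P

  mixed⁺ : ∀ {a} → a ≤ n → z a ≢ 0 → x a ≢ 0 → 1 ≤ c a
  mixed⁺ {a} a≤n z≢0 x≢0 with mixed a a≤n
  ... | inj₁ x≡0 = ⊥-elim (x≢0 x≡0)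
  ... | inj₂ (inj₁ z≡0) = ⊥-elim (z≢0 z≡0)
  ... | inj₂ (inj₂ 1≤c) = 1≤c

  length-positive : ∀ {a} → a ≤ n → 1 ≤ x a + z a
  length-positive {a} a≤n with m≤n⇒m<n∨m≡n a≤n
  ... | inj₁ a<n rewrite next a a<n = s≤s z≤n
  ... | inj₂ refl = ≤-reflexive (sym last)

  -- When `onward` only says that column `suc a` fills up, it helps that column `a` is not full:
  -- `x a` is then at most its length less one, which is the length of column `suc a`.
  forward : ∀ {a} → a < n → z a ≢ 0 → x a ≤ x (suc a) + c (suc a)
  forward {a} a<n z≢0 with onward a a<n
  ... | inj₂ le = le
  ... | inj₁ z≤c = ≤-pred (begin
    suc (x a)                     ≤⟨ m≤m+n _ _ ⟩
    suc (x a) + pred (z a)        ≡⟨ sym (+-suc _ _) ⟩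
    x a + suc (pred (z a))        ≡⟨ cong (x a +_) (suc-pred (z a) ⦃ ≢-nonZero z≢0 ⦄) ⟩
    x a + z a                     ≡⟨ next a a<n ⟩
    suc (x (suc a) + z (suc a))   ≤⟨ s≤s (+-monoʳ-≤ (x (suc a)) z≤c) ⟩
    suc (x (suc a) + c (suc a))   ∎)
    where open ≤-Reasoning

  -- x a ≤ x (suc a) + c (suc a), read on the deficits: column a is one point longer than
  -- column (suc a).  The predecessor is truncated when column a is full.
  forward-pred : ∀ {a} → a < n → z (suc a) ≤ c (suc a) + pred (z a)
  forward-pred {a} a<n with onward a a<n
  ... | inj₁ z≤c = ≤-trans z≤c (m≤m+n _ _)
  ... | inj₂ le with z a | next a a<n
  ...   | zero | eq = ≤-trans (<⇒≤ (+-cancelˡ-≤ (x (suc a)) _ _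
            (≤-trans (≤-reflexive (trans (+-suc _ _) (trans (sym eq) (+-identityʳ _)))) le))) (m≤m+n _ _)
  ...   | suc w | eq = +-cancelˡ-≤ (x (suc a)) _ _ (begin
            x (suc a) + z (suc a)      ≡⟨ suc-injective (trans (sym eq) (+-suc _ _)) ⟩
            x a + w                    ≤⟨ +-monoˡ-≤ w le ⟩
            x (suc a) + c (suc a) + w  ≡⟨ +-assoc (x (suc a)) _ _ ⟩
            x (suc a) + (c (suc a) + w) ∎)
    where open ≤-Reasoning

  -- The `suc` in `back` is the difference in length of the two columns, so it cancels on passing to
  -- deficits.
  backward : ∀ {a} → a < n → x (suc a) ≢ 0 → z a ≤ z (suc a) + c a
  backward {a} a<n x≢0 with back a a<n
  ... | inj₁ x≡0 = ⊥-elim (x≢0 x≡0)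
  ... | inj₂ le = +-cancelˡ-≤ (x a) _ _ (begin
    x a + z a                     ≡⟨ next a a<n ⟩
    suc (x (suc a)) + z (suc a)   ≤⟨ +-monoˡ-≤ (z (suc a)) le ⟩
    x a + c a + z (suc a)         ≡⟨ +-assoc (x a) _ _ ⟩
    x a + (c a + z (suc a))       ≡⟨ cong (x a +_) (+-comm (c a) _) ⟩
    x a + (z (suc a) + c a)       ∎)
    where open ≤-Reasoning

  -- Each step to the left from a column raises the count by at most that column's `c`, and a
  -- nonempty column costs at least one. With `Q` the sum of the `c`, the bound is twice the area of
  -- a `Q` by `x e` rectangle and a right triangle with legs `Q`.
  no-full-upto : ∀ {e} → e ≤ n → (∀ a → a ≤ e → z a ≢ 0) →
    2 * ∑ (suc e) x ≤ 2 * (∑ (suc e) c * x e) + ∑ (suc e) c * ∑ (suc e) c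
  no-full-below : ∀ {e} → e ≤ n → (∀ a → a < e → z a ≢ 0) →
    2 * ∑ e x ≤ 2 * (∑ e c * (x e + c e)) + ∑ e c * ∑ e c

  no-full-upto {e} e≤n nf = begin
    2 * (∑ e x + x e)
      ≡⟨ *-distribˡ-+ 2 (∑ e x) (x e) ⟩
    2 * ∑ e x + 2 * x e
      ≤⟨ +-monoˡ-≤ (2 * x e) (no-full-below e≤n (λ a a<e → nf a (<⇒≤ a<e))) ⟩
    2 * (∑ e c * (x e + c e)) + ∑ e c * ∑ e c + 2 * x e
      ≤⟨ +-monoʳ-≤ (2 * (∑ e c * (x e + c e)) + ∑ e c * ∑ e c) (*-monoʳ-≤ 2 x≤c*x) ⟩
    2 * (∑ e c * (x e + c e)) + ∑ e c * ∑ e c + 2 * (c e * x e)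
      ≤⟨ ≤-by (c e * c e) (eq (∑ e c) (x e) (c e)) ⟩
    2 * ((∑ e c + c e) * x e) + (∑ e c + c e) * (∑ e c + c e)
      ∎
    where
    open ≤-Reasoning
    eq : ∀ Q x c → 2 * ((Q + c) * x) + (Q + c) * (Q + c) ≡
                   2 * (Q * (x + c)) + Q * Q + 2 * (c * x) + c * c
    eq = solve-∀
    x≤c*x : x e ≤ c e * x e
    x≤c*x with mixed e e≤n
    ... | inj₁ x≡0 rewrite x≡0 = z≤n
    ... | inj₂ (inj₁ z≡0) = ⊥-elim (nf e ≤-refl z≡0)
    ... | inj₂ (inj₂ 1≤c) = ≤-trans (≤-reflexive (sym (*-identityˡ (x e)))) (*-monoˡ-≤ (x e) 1≤c)

  no-full-below {zero} _ _ = z≤n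
  no-full-below {suc e} e<n nf = ≤-trans (no-full-upto (<⇒≤ e<n) (λ a a≤e → nf a (s≤s a≤e)))
    (+-monoˡ-≤ _ (*-monoʳ-≤ 2 (*-monoʳ-≤ (∑ (suc e) c) (forward e<n (nf e ≤-refl)))))

  no-full : (∀ a → a ≤ n → z a ≢ 0) → 2 * ∑ (suc n) x ≤ ∑ (suc n) c * ∑ (suc n) c
  no-full nf = ≤-trans (no-full-upto ≤-refl nf) (≤-reflexive lemma)
    where
    lemma : 2 * (∑ (suc n) c * x n) + ∑ (suc n) c * ∑ (suc n) c ≡ ∑ (suc n) c * ∑ (suc n) c
    -- The last column has a single point; not being full it is empty, and the rectangle term
    -- vanishes.
    lemma with x n | z n | last | nf n ≤-refl
    ... | zero | _ | _ | _ rewrite *-zeroʳ (∑ n c + c n) = refl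
    ... | suc zero | zero | _ | z≢0 = ⊥-elim (z≢0 refl)

  -- The columns from `e` on are counted as full; they form a triangle of side `x e + z e`.
  ∑x-tail : ∀ {e} d → e + d ≡ n →
    2 * ∑ (suc n) x ≤ 2 * ∑ e x + (x e + z e) * suc (x e + z e)
  ∑x-tail {e} zero eq rewrite +-identityʳ e | eq | last =
    ≤-trans (≤-reflexive (*-distribˡ-+ 2 (∑ n x) (x n)))
      (+-monoʳ-≤ (2 * ∑ n x) (*-monoʳ-≤ 2 (≤-trans (m≤m+n (x n) _) (≤-reflexive last))))
  ∑x-tail {e} (suc d) eq = begin
    2 * ∑ (suc n) x                                         ≤⟨ ∑x-tail d (trans (sym (+-suc e d)) eq) ⟩
    2 * (∑ e x + x e) + ℓ * suc ℓ                           ≤⟨ +-monoˡ-≤ (ℓ * suc ℓ) (*-monoʳ-≤ 2 (+-monoʳ-≤ (∑ e x) x≤)) ⟩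
    2 * (∑ e x + suc ℓ) + ℓ * suc ℓ                         ≡⟨ eq′ (∑ e x) ℓ ⟩
    2 * ∑ e x + suc ℓ * suc (suc ℓ)                         ≡⟨ cong (λ k → 2 * ∑ e x + k * suc k) (sym (next e e<n)) ⟩
    2 * ∑ e x + (x e + z e) * suc (x e + z e)               ∎
    where
    open ≤-Reasoning
    ℓ = x (suc e) + z (suc e)
    e<n : e < n
    e<n = ≤-by d (sym (trans (sym (+-suc e d)) eq))
    x≤ : x e ≤ suc ℓ
    x≤ = ≤-trans (m≤m+n _ (z e)) (≤-reflexive (next e e<n))
    eq′ : ∀ X ℓ → 2 * (X + suc ℓ) + ℓ * suc ℓ ≡ 2 * X + suc ℓ * suc (suc ℓ)
    eq′ = solve-∀

  -- Across nonempty columns the frontier must make up any deficit.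
  climb : ∀ {e p} → e ≤′ p → p ≤ n → (∀ a → e < a → a ≤ p → x a ≢ 0) →
    ∑ e c + z e ≤ ∑ p c + z p
  climb ≤′-refl _ _ = ≤-refl
  climb {e} {suc p} (≤′-step e≤p) p<n ne = begin
    ∑ e c + z e               ≤⟨ climb e≤p (<⇒≤ p<n) (λ a e<a a≤p → ne a e<a (m≤n⇒m≤1+n a≤p)) ⟩
    ∑ p c + z p               ≤⟨ +-monoʳ-≤ (∑ p c) (backward p<n (ne (suc p) (s≤s (≤′⇒≤ e≤p)) ≤-refl)) ⟩
    ∑ p c + (z (suc p) + c p) ≡⟨ cong (∑ p c +_) (+-comm (z (suc p)) (c p)) ⟩
    ∑ p c + (c p + z (suc p)) ≡⟨ sym (+-assoc (∑ p c) _ _) ⟩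
    ∑ p c + c p + z (suc p)   ∎
    where open ≤-Reasoning

  -- Left of `e`, use `no-full-below` with `x e = 0` and `c e ≤ z e`; the columns right of `e`,
  -- counted as full, give at most `z e * z e` after doubling. The sum is the square of
  -- `∑ e c + z e`, which `climb`, from the empty column to the full one, bounds by the total of the
  -- `c`.
  empty-before-full : ∀ {e p} → e < p → p ≤ n → z p ≡ 0 → x e ≡ 0 →
    (∀ a → a < p → z a ≢ 0) → (∀ a → e < a → a ≤ p → x a ≢ 0) →
    2 * ∑ (suc n) x ≤ ∑ (suc n) c * ∑ (suc n) c
  empty-before-full {e} {p} e<p p≤n zp≡0 xe≡0 nf ne = begin
    2 * ∑ (suc n) x                         ≤⟨ ∑x-tail (n ∸ suc e) (m+[n∸m]≡n e<n) ⟩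
    2 * (∑ e x + x e) + ℓ * suc ℓ           ≡⟨ cong (λ k → 2 * k + ℓ * suc ℓ) (trans (cong (∑ e x +_) xe≡0) (+-identityʳ _)) ⟩
    2 * ∑ e x + ℓ * suc ℓ                   ≤⟨ +-mono-≤ (no-full-below (<⇒≤ e<n) (λ a a<e → nf a (<-trans a<e e<p))) (*-monoˡ-≤ (suc ℓ) (n≤1+n ℓ)) ⟩
    2 * (∑ e c * (x e + c e)) + ∑ e c * ∑ e c + suc ℓ * suc ℓ
      ≤⟨ +-mono-≤ (+-monoˡ-≤ _ (*-monoʳ-≤ 2 (*-monoʳ-≤ (∑ e c) (subst (λ k → k + c e ≤ z e) (sym xe≡0) (c≤z e (<⇒≤ e<n))))))
           (≤-reflexive (cong (λ k → k * k) (sym ze≡))) ⟩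
    2 * (∑ e c * z e) + ∑ e c * ∑ e c + z e * z e  ≡⟨ eq (∑ e c) (z e) ⟩
    (∑ e c + z e) * (∑ e c + z e)           ≤⟨ *-mono-≤ total total ⟩
    ∑ (suc n) c * ∑ (suc n) c               ∎
    where
    open ≤-Reasoning
    ℓ = x (suc e) + z (suc e)
    e<n : e < n
    e<n = <-≤-trans e<p p≤n
    ze≡ : z e ≡ suc ℓ
    ze≡ = trans (sym (cong (_+ z e) xe≡0)) (next e e<n)
    eq : ∀ Q z → 2 * (Q * z) + Q * Q + z * z ≡ (Q + z) * (Q + z)
    eq = solve-∀
    total : ∑ e c + z e ≤ ∑ (suc n) c
    total = begin
      ∑ e c + z e ≤⟨ climb (≤⇒≤′ (<⇒≤ e<p)) p≤n ne ⟩
      ∑ p c + z p ≡⟨ trans (cong (∑ p c +_) zp≡0) (+-identityʳ _) ⟩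
      ∑ p c       ≤⟨ ∑-mono-length c (m≤n⇒m≤1+n p≤n) ⟩
      ∑ (suc n) c ∎

  -- The analogue of `no-full-below` for deficits: every column before `p` is neither empty nor
  -- full, so its `c` is at least one. `backward` charges a column's own `c` instead of its right
  -- neighbour's, so the triangle includes its diagonal: hence the extra `∑ e c`.
  deficit-left : ∀ {e p} → e ≤ p → p ≤ n → (∀ a → a < p → z a ≢ 0) → (∀ a → a ≤ p → x a ≢ 0) →
    2 * ∑ e z ≤ 2 * (∑ e c * z e) + (∑ e c * ∑ e c + ∑ e c)
  deficit-left {zero} _ _ _ _ = z≤n
  deficit-left {suc e} e<p p≤n nf ne = begin
    2 * (∑ e z + z e)
      ≡⟨ *-distribˡ-+ 2 (∑ e z) (z e) ⟩
    2 * ∑ e z + 2 * z e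
      ≤⟨ +-monoˡ-≤ _ (deficit-left (<⇒≤ e<p) p≤n nf ne) ⟩
    2 * (Q * z e) + (Q * Q + Q) + 2 * z e
      ≡⟨ eq₁ Q (z e) ⟩
    2 * (suc Q * z e) + (Q * Q + Q)
      ≤⟨ +-monoˡ-≤ _ (*-monoʳ-≤ 2 (*-monoʳ-≤ (suc Q) (backward e<n (ne (suc e) e<p)))) ⟩
    2 * (suc Q * (z (suc e) + c e)) + (Q * Q + Q)
      ≤⟨ lemma (mixed⁺ (<⇒≤ e<n) (nf e e<p) (ne e (<⇒≤ e<p))) ⟩
    2 * ((Q + c e) * z (suc e)) + ((Q + c e) * (Q + c e) + (Q + c e))
      ∎
    where
    open ≤-Reasoning
    Q = ∑ e c
    e<n : e < n
    e<n = <-≤-trans e<p p≤n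
    eq₁ : ∀ Q z → 2 * (Q * z) + (Q * Q + Q) + 2 * z ≡ 2 * (suc Q * z) + (Q * Q + Q)
    eq₁ = solve-∀
    eq₂ : ∀ Q z c → 2 * ((Q + suc c) * z) + ((Q + suc c) * (Q + suc c) + (Q + suc c)) ≡
                    2 * (suc Q * (z + suc c)) + (Q * Q + Q) + (2 * c * z + c * c + c)
    eq₂ = solve-∀
    lemma : ∀ {c} → 1 ≤ c → 2 * (suc Q * (z (suc e) + c)) + (Q * Q + Q) ≤
                    2 * ((Q + c) * z (suc e)) + ((Q + c) * (Q + c) + (Q + c))
    lemma {suc c} _ = ≤-by _ (eq₂ Q (z (suc e)) c)

  -- Without further cost the deficits to the right of b can still be z b - 1, z b - 2, …, 1;
  -- the invariant accounts for them in advance.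
  deficit-right : ∀ {p b} → p ≤′ b → b ≤ n → z p ≡ 0 → 2 * ∑ p z ≤ ∑ p c * suc (∑ p c) →
    pred (z b) ≤ ∑ (suc b) c ×
    2 * ∑ (suc b) z + pred (z b) * suc (pred (z b)) ≤ ∑ (suc b) c * suc (∑ (suc b) c)
  deficit-right {p} ≤′-refl _ zp≡0 init rewrite zp≡0 = z≤n , (begin
      2 * (∑ p z + 0) + 0               ≡⟨ trans (+-identityʳ (2 * (∑ p z + 0))) (cong (2 *_) (+-identityʳ (∑ p z))) ⟩
      2 * ∑ p z                         ≤⟨ init ⟩
      ∑ p c * suc (∑ p c)               ≤⟨ *-mono-≤ (m≤m+n (∑ p c) (c p)) (s≤s (m≤m+n (∑ p c) (c p))) ⟩
      ∑ (suc p) c * suc (∑ (suc p) c)   ∎)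
    where open ≤-Reasoning
  deficit-right {p} {suc b} (≤′-step p≤b) b<n zp≡0 init
    with w≤R , inv ← deficit-right p≤b (<⇒≤ b<n) zp≡0 init =
      ≤-trans (pred[n]≤n {z (suc b)}) z≤R , (begin
      2 * (Z + z (suc b)) + pred (z (suc b)) * suc (pred (z (suc b)))
        ≡⟨ eq₁ (z (suc b)) ⟩
      2 * Z + z (suc b) * suc (z (suc b))
        ≤⟨ +-monoʳ-≤ (2 * Z) (*-mono-≤ step (s≤s step)) ⟩
      2 * Z + (c (suc b) + w) * suc (c (suc b) + w)
        ≡⟨ eq₂ Z (c (suc b)) w ⟩
      (2 * Z + w * suc w) + (c (suc b) * c (suc b) + 2 * c (suc b) * w + c (suc b))
        -- The bound `w ≤ R`, carried along as the first component, controls the cross term.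
        ≤⟨ +-mono-≤ inv (+-monoˡ-≤ (c (suc b)) (+-monoʳ-≤ (c (suc b) * c (suc b)) (*-monoʳ-≤ (2 * c (suc b)) w≤R))) ⟩
      R * suc R + (c (suc b) * c (suc b) + 2 * c (suc b) * R + c (suc b))
        ≡⟨ eq₃ R (c (suc b)) ⟩
      (R + c (suc b)) * suc (R + c (suc b)) ∎)
    where
    open ≤-Reasoning
    w = pred (z b)
    R = ∑ (suc b) c
    Z = ∑ (suc b) z
    step : z (suc b) ≤ c (suc b) + w
    step = forward-pred b<n
    z≤R : z (suc b) ≤ R + c (suc b)
    z≤R = ≤-trans step (≤-trans (+-monoʳ-≤ (c (suc b)) w≤R) (≤-reflexive (+-comm (c (suc b)) R)))
    eq₀ : ∀ Z v → 2 * (Z + suc v) + v * suc v ≡ 2 * Z + suc v * suc (suc v)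
    eq₀ = solve-∀
    eq₁ : ∀ v → 2 * (Z + v) + pred v * suc (pred v) ≡ 2 * Z + v * suc v
    eq₁ zero = cong (λ k → 2 * k + 0) (+-identityʳ Z)
    eq₁ (suc v) = eq₀ Z v
    eq₂ : ∀ Z c w → 2 * Z + (c + w) * suc (c + w) ≡ (2 * Z + w * suc w) + (c * c + 2 * c * w + c)
    eq₂ = solve-∀
    eq₃ : ∀ R c → R * suc R + (c * c + 2 * c * R + c) ≡ (R + c) * suc (R + c)
    eq₃ = solve-∀

  -- p is the first full column and e the last empty column before it.
  isoperimetry₁ : 2 * ∑ (suc n) x ≤ ∑ (suc n) c * ∑ (suc n) c
                ⊎ 2 * ∑ (suc n) z ≤ ∑ (suc n) c * suc (∑ (suc n) c)
  isoperimetry₁ with least (λ a → z a ≟ 0) (suc n)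
  ... | inj₂ nf = inj₁ (no-full (λ a a≤n → nf a (s≤s a≤n)))
  ... | inj₁ (p , zp≡0 , p-least) with p ≤? n
  -- A first zero of `z` beyond `n` means that no column of the triangle is full.
  ...   | no p≰n = inj₁ (no-full λ a a≤n za≡0 → p≰n (≤-trans (p-least a za≡0) a≤n))
  ...   | yes p≤n with greatest-below (λ a → x a ≟ 0) p
  ...     | inj₁ (e , e<p , xe≡0 , e-greatest) = inj₁ (empty-before-full e<p p≤n zp≡0 xe≡0 nf ne)
    where
    nf : ∀ a → a < p → z a ≢ 0
    nf a a<p za≡0 = <⇒≱ a<p (p-least a za≡0)
    ne : ∀ a → e < a → a ≤ p → x a ≢ 0
    ne a e<a a≤p xa≡0 with m≤n⇒m<n∨m≡n a≤p
    ... | inj₁ a<p = e-greatest a e<a a<p xa≡0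
    ... | inj₂ refl = case ≤-trans (length-positive p≤n) (≤-reflexive (cong₂ _+_ xa≡0 zp≡0)) of λ ()
  ...     | inj₂ ne′ = inj₂ (≤-trans (m≤m+n _ _) (proj₂ (deficit-right (≤⇒≤′ p≤n) ≤-refl zp≡0 start)))
    where
    nf : ∀ a → a < p → z a ≢ 0
    nf a a<p za≡0 = <⇒≱ a<p (p-least a za≡0)
    ne : ∀ a → a ≤ p → x a ≢ 0
    ne a a≤p xa≡0 with m≤n⇒m<n∨m≡n a≤p
    ... | inj₁ a<p = ne′ a a<p xa≡0
    ... | inj₂ refl = case ≤-trans (length-positive p≤n) (≤-reflexive (cong₂ _+_ xa≡0 zp≡0)) of λ ()
    eq : ∀ Q → 2 * (Q * 0) + (Q * Q + Q) ≡ Q * suc Q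
    eq = solve-∀
    start : 2 * ∑ p z ≤ ∑ p c * suc (∑ p c)
    start = ≤-trans (deficit-left ≤-refl p≤n nf ne)
      (≤-reflexive (trans (cong (λ k → 2 * (∑ p c * k) + (∑ p c * ∑ p c + ∑ p c)) zp≡0) (eq (∑ p c))))

-- Stabilisation of an increasing chain of predicates on a finite list.

module _ {X : Set} (P : ℕ → X → Set) (P? : ∀ t → Decidable (P t))
         (P-mono : ∀ t {x} → P t x → P (suc t) x) (xs : List X) where

  Stable : ℕ → Set
  Stable t = ∀ {x} → x ∈ xs → P (suc t) x → P t x

  count-mono : ∀ t ys → length (filter (P? t) ys) ≤ length (filter (P? (suc t)) ys)
  count-mono t [] = z≤n
  count-mono t (y ∷ ys) with P? t y | P? (suc t) y
  ... | yes p | yes q = s≤s (count-mono t ys)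
  ... | yes p | no ¬q = ⊥-elim (¬q (P-mono t p))
  ... | no ¬p | yes q = m≤n⇒m≤1+n (count-mono t ys)
  ... | no ¬p | no ¬q = count-mono t ys

  count-strict : ∀ t {ys} → Any (λ x → ¬ (P (suc t) x → P t x)) ys →
    length (filter (P? t) ys) < length (filter (P? (suc t)) ys)
  count-strict t {y ∷ ys} (here ¬stable) with P? t y | P? (suc t) y
  ... | yes p | _ = ⊥-elim (¬stable (λ _ → p))
  ... | no ¬p | yes q = s≤s (count-mono t ys)
  ... | no ¬p | no ¬q = ⊥-elim (¬stable (λ q → ⊥-elim (¬q q)))
  count-strict t {y ∷ ys} (there any) with P? t y | P? (suc t) y
  ... | yes p | yes q = s≤s (count-strict t any)
  ... | yes p | no ¬q = ⊥-elim (¬q (P-mono t p))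
  ... | no ¬p | yes q = m≤n⇒m≤1+n (count-strict t any)
  ... | no ¬p | no ¬q = count-strict t any

  -- Each turn before the first stable one wins at least one new state.
  stable-or-large : ∀ t → (∃ λ s → s ≤ t × Stable s) ⊎ t ≤ length (filter (P? t) xs)
  stable-or-large zero = inj₂ z≤n
  stable-or-large (suc t) with stable-or-large t
  ... | inj₁ (s , s≤t , st) = inj₁ (s , m≤n⇒m≤1+n s≤t , st)
  ... | inj₂ large with all? (λ x → P? (suc t) x →-dec P? t x) xs
  ...   | yes st = inj₁ (t , n≤1+n t , λ x∈xs → All.lookup st x∈xs)
  ...   | no ¬st = inj₂ (≤-<-trans large
            (count-strict t (¬All⇒Any¬ (λ x → P? (suc t) x →-dec P? t x) xs ¬st)))

  stabilises : ∃ Stable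
  stabilises with stable-or-large (suc (length xs))
  ... | inj₁ (s , _ , st) = s , st
  ... | inj₂ large = ⊥-elim (<⇒≱ large (length-filter (P? (suc (length xs))) xs))

  module _ (stable-suc : ∀ t → Stable t → Stable (suc t)) where

    -- Stability persists from the first stable turn `s`, so turn `s` decides everything: a witness
    -- at `t` is carried up to `s + t` by monotonicity and down to `s` by stability.
    eventually? : ∀ {x} → x ∈ xs → Dec (∃ λ t → P t x)
    eventually? {x} x∈xs with s , st ← stabilises = map′ (s ,_) (λ (t , p) → collapse t p) (P? s x)
      where
      stable-+ : ∀ d → Stable (d + s)
      stable-+ zero = st
      stable-+ (suc d) = stable-suc (d + s) (stable-+ d)
      descend : ∀ d → P (d + s) x → P s x
      descend zero p = p
      descend (suc d) p = descend d (stable-+ d x∈xs p)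
      ascend : ∀ d {t} → P t x → P (d + t) x
      ascend zero p = p
      ascend (suc d) p = P-mono _ (ascend d p)
      collapse : ∀ t → P t x → P s x
      collapse t p = descend t (subst (λ k → P k x) (+-comm s t) (ascend s p))

-- Enumeration of sublists and of bounded lists.

sublists : {X : Set} → List X → List (List X)
sublists [] = [] ∷ []
sublists (x ∷ xs) = map (x ∷_) (sublists xs) ++ sublists xs

-- Sets of possible positions are filters of the vertex list, so this confines the game to finitely
-- many states.
filter∈sublists : {X : Set} {P : X → Set} (P? : Decidable P) → ∀ xs → filter P? xs ∈ sublists xs
filter∈sublists P? [] = here refl
filter∈sublists P? (x ∷ xs) with does (P? x)
... | true = ∈-++⁺ˡ (∈-map⁺ (x ∷_) (filter∈sublists P? xs))
... | false = ∈-++⁺ʳ (map (x ∷_) (sublists xs)) (filter∈sublists P? xs)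

self∈sublists : {X : Set} (xs : List X) → xs ∈ sublists xs
self∈sublists [] = here refl
self∈sublists (x ∷ xs) = ∈-++⁺ˡ (∈-map⁺ (x ∷_) (self∈sublists xs))

listsUpTo : {X : Set} → ℕ → List X → List (List X)
listsUpTo zero xs = [] ∷ []
listsUpTo (suc k) xs = [] ∷ cartesianProductWith _∷_ xs (listsUpTo k xs)

∈-listsUpTo⁺ : {X : Set} {xs : List X} → ∀ k {ys} → length ys ≤ k → All (_∈ xs) ys → ys ∈ listsUpTo k xs
∈-listsUpTo⁺ zero {[]} _ _ = here refl
∈-listsUpTo⁺ (suc k) {[]} _ _ = here refl
∈-listsUpTo⁺ (suc k) {y ∷ ys} (s≤s le) (y∈xs ∷ ys∈xs) =
  there (∈-cartesianProductWith⁺ _∷_ y∈xs (∈-listsUpTo⁺ k le ys∈xs))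

∈-listsUpTo⁻ : {X : Set} {xs : List X} → ∀ k {ys} → ys ∈ listsUpTo k xs → length ys ≤ k × All (_∈ xs) ys
∈-listsUpTo⁻ zero (here refl) = z≤n , []
∈-listsUpTo⁻ (suc k) (here refl) = z≤n , []
∈-listsUpTo⁻ {xs = xs} (suc k) (there ys∈)
  with y , zs , y∈xs , zs∈ , refl ← ∈-cartesianProductWith⁻ _∷_ xs (listsUpTo k xs) ys∈
  with le , all ← ∈-listsUpTo⁻ k zs∈ = s≤s le , y∈xs ∷ all

-- Closed neighbourhoods and the spread of the intruder.

inT? : ∀ n → Decidable (InT n)
inT? n (a , b) = a + b ≤? n

-- The closed neighbourhood in the whole quadrant, not only in the triangle.
neighbours : Pt → List Pt
neighbours (a , b) = (a , b) ∷ (suc a , b) ∷ (a , suc b) ∷ lefts a b ++ downs a b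
  where
  lefts : ℕ → ℕ → List Pt
  lefts zero b = []
  lefts (suc a) b = (a , b) ∷ (a , suc b) ∷ []
  downs : ℕ → ℕ → List Pt
  downs a zero = []
  downs a (suc b) = (a , b) ∷ (suc a , b) ∷ []

∈-neighbours⁺ : ∀ {x y} → StayOrMove x y → y ∈ neighbours x
∈-neighbours⁺ (inj₁ refl) = here refl
∈-neighbours⁺ (inj₂ (right a b)) = there (here refl)
∈-neighbours⁺ (inj₂ (up a b)) = there (there (here refl))
∈-neighbours⁺ (inj₂ (left a b)) = there (there (there (here refl)))
∈-neighbours⁺ (inj₂ (diagUL a b)) = there (there (there (there (here refl))))
∈-neighbours⁺ (inj₂ (down zero b)) = there (there (there (here refl)))
∈-neighbours⁺ (inj₂ (down (suc a) b)) = there (there (there (there (there (here refl)))))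
∈-neighbours⁺ (inj₂ (diagDR zero b)) = there (there (there (there (here refl))))
∈-neighbours⁺ (inj₂ (diagDR (suc a) b)) = there (there (there (there (there (there (here refl))))))

∈-neighbours⁻ : ∀ x {y} → y ∈ neighbours x → StayOrMove x y
∈-neighbours⁻ (a , b) (here refl) = inj₁ refl
∈-neighbours⁻ (a , b) (there (here refl)) = inj₂ (right a b)
∈-neighbours⁻ (a , b) (there (there (here refl))) = inj₂ (up a b)
∈-neighbours⁻ (suc a , b) (there (there (there (here refl)))) = inj₂ (left a b)
∈-neighbours⁻ (suc a , b) (there (there (there (there (here refl))))) = inj₂ (diagUL a b)
∈-neighbours⁻ (zero , suc b) (there (there (there (here refl)))) = inj₂ (down zero b)
∈-neighbours⁻ (zero , suc b) (there (there (there (there (here refl))))) = inj₂ (diagDR zero b)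
∈-neighbours⁻ (suc a , suc b) (there (there (there (there (there (here refl)))))) = inj₂ (down (suc a) b)
∈-neighbours⁻ (suc a , suc b) (there (there (there (there (there (there (here refl))))))) = inj₂ (diagDR (suc a) b)

stayOrMove? : ∀ x y → Dec (StayOrMove x y)
stayOrMove? x y = map′ (∈-neighbours⁻ x) ∈-neighbours⁺ (y ∈? neighbours x)

vertices : ℕ → List Pt
vertices n = filter (inT? n) (cartesianProduct (upTo (suc n)) (upTo (suc n)))

∈-vertices⁺ : ∀ {n x} → InT n x → x ∈ vertices n
∈-vertices⁺ {n} {a , b} a+b≤n = ∈-filter⁺ (inT? n)
  (∈-cartesianProduct⁺ (∈-upTo⁺ (s≤s (≤-trans (m≤m+n a b) a+b≤n))) (∈-upTo⁺ (s≤s (≤-trans (m≤n+m b a) a+b≤n)))) a+b≤n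

∈-vertices⁻ : ∀ {n x} → x ∈ vertices n → InT n x
∈-vertices⁻ {n} = proj₂ ∘ ∈-filter⁻ (inT? n) {xs = cartesianProduct (upTo (suc n)) (upTo (suc n))}

Reaches : List Pt → List Pt → Pt → Pt → Set
Reaches C S y x = x ∉ S × StayOrMove x y

reaches? : ∀ C S y → Decidable (Reaches C S y)
reaches? C S y x = ¬? (x ∈? S) ×-dec stayOrMove? x y

-- The possible positions after the intruder survives the examination of `S` and moves. Filtering
-- `vertices n` makes this one of its sublists.
spread : ℕ → List Pt → List Pt → List Pt
spread n S C = filter (λ y → any? (reaches? C S y) C) (vertices n)

∈-spread⁺ : ∀ {n S C x y} → x ∈ C → x ∉ S → StayOrMove x y → InT n y → y ∈ spread n S C
∈-spread⁺ {n} {S} {C} {x} {y} x∈C x∉S x~y y∈T =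
  ∈-filter⁺ (λ y → any? (reaches? C S y) C) (∈-vertices⁺ y∈T) (lose {P = Reaches C S y} x∈C (x∉S , x~y))

∈-spread⁻ : ∀ {n S C y} → y ∈ spread n S C → InT n y × ∃ λ x → x ∈ C × x ∉ S × StayOrMove x y
∈-spread⁻ {n} {S} {C} {y} y∈
  with y∈V , any ← ∈-filter⁻ (λ y → any? (reaches? C S y) C) {xs = vertices n} y∈
  with x , x∈C , x∉S , x~y ← find {P = Reaches C S y} any = ∈-vertices⁻ y∈V , x , x∈C , x∉S , x~y

evades-∷ : ∀ {n x y S} Ss → x ∉ S → StayOrMove x y → InT n y → Evades n y Ss → Evades n x (S ∷ Ss)
evades-∷ [] x∉S _ _ _ = x∉S
evades-∷ (_ ∷ _) x∉S x~y y∈T ev = x∉S , _ , y∈T , x~y , ev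

-- `Evades` asks for no move after the last examination; staying put supplies one.
evades-uncons : ∀ {n x S} Ss → InT n x → Evades n x (S ∷ Ss) →
  x ∉ S × ∃ λ y → InT n y × StayOrMove x y × Evades n y Ss
evades-uncons [] x∈T x∉S = x∉S , _ , x∈T , inj₁ refl , tt
evades-uncons (_ ∷ _) _ ev = ev

-- Composition of strategies.

Legal : ℕ → ℕ → List Pt → Set
Legal n k S = length S ≤ k × All (InT n) S

Clearable : ℕ → ℕ → (Pt → Set) → Set
Clearable n k C = ∃ λ Ss → All (Legal n k) Ss × (∀ x → InT n x → C x → ¬ Evades n x Ss)

clear-none : ∀ {n k C} → (∀ x → InT n x → ¬ C x) → Clearable n k C
clear-none none = [] , [] , λ x x∈T Cx _ → none x x∈T Cx

clear-⊆ : ∀ {n k C C′} → (∀ x → InT n x → C x → C′ x) → Clearable n k C′ → Clearable n k C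
clear-⊆ C⊆C′ (Ss , legal , win) = Ss , legal , λ x x∈T Cx → win x x∈T (C⊆C′ x x∈T Cx)

-- Any `C′` containing the true spread will do. The guard may have points outside the triangle: they
-- are filtered out to make the move legal, and the intruder never occupies them.
clear-step : ∀ {n k C C′} S → length S ≤ k →
  (∀ x y → InT n x → InT n y → C x → x ∉ S → StayOrMove x y → C′ y) →
  Clearable n k C′ → Clearable n k C
clear-step {n} S |S|≤k spreads (Ss , legal , win) =
  filter (inT? n) S ∷ Ss ,
  (≤-trans (length-filter (inT? n) S) |S|≤k ,
    All.tabulate (λ x∈ → proj₂ (∈-filter⁻ (inT? n) {xs = S} x∈))) ∷ legal ,
  λ x x∈T Cx ev → case evades-uncons Ss x∈T ev of λ where
    (x∉S , y , y∈T , x~y , ev′) →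
      win y y∈T (spreads x y x∈T y∈T Cx (λ x∈S → x∉S (∈-filter⁺ (inT? n) x∈S x∈T)) x~y) ev′

clearable⇒winning : ∀ {n k} → Clearable n k (λ _ → ⊤) → HasWinningStrategy n k
clearable⇒winning (Ss , legal , win) = Ss , legal , λ (x , x∈T , ev) → win x x∈T tt ev

-- Decidability of winning.

ClearsIn : ℕ → ℕ → ℕ → List Pt → Set
ClearsIn n k zero C = C ≡ []
ClearsIn n k (suc t) C = C ≡ [] ⊎ Any (λ S → ClearsIn n k t (spread n S C)) (listsUpTo k (vertices n))

empty? : {X : Set} (xs : List X) → Dec (xs ≡ [])
empty? [] = yes refl
empty? (x ∷ xs) = no λ ()

clearsIn? : ∀ n k t → Decidable (ClearsIn n k t)
clearsIn? n k zero C = empty? C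
clearsIn? n k (suc t) C = empty? C ⊎-dec any? (λ S → clearsIn? n k t (spread n S C)) _

-- The early exit `C ≡ []` makes `t` an upper bound on the number of turns, which gives the
-- monotonicity that stabilisation needs.
clearsIn-suc : ∀ n k t {C} → ClearsIn n k t C → ClearsIn n k (suc t) C
clearsIn-suc n k zero C≡[] = inj₁ C≡[]
clearsIn-suc n k (suc t) (inj₁ C≡[]) = inj₁ C≡[]
clearsIn-suc n k (suc t) (inj₂ any) = inj₂ (Any.map (clearsIn-suc n k t) any)

clearsIn⇒clearable : ∀ n k t {C} → All (InT n) C → ClearsIn n k t C → Clearable n k (_∈ C)
clearsIn⇒clearable n k zero _ refl = clear-none λ _ _ ()
clearsIn⇒clearable n k (suc t) _ (inj₁ refl) = clear-none λ _ _ ()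
clearsIn⇒clearable n k (suc t) {C} C⊆T (inj₂ any) with S , S∈ , cl ← find any =
  clear-step S (proj₁ (∈-listsUpTo⁻ k S∈))
    (λ x y _ y∈T x∈C x∉S x~y → ∈-spread⁺ x∈C x∉S x~y y∈T)
    (clearsIn⇒clearable n k t (All.tabulate (λ y∈ → proj₁ (∈-spread⁻ {n} {S} {C} y∈))) cl)

strategy⇒clearsIn : ∀ n k Ss {C} → All (Legal n k) Ss → All (InT n) C →
  (∀ x → x ∈ C → ¬ Evades n x Ss) → ClearsIn n k (length Ss) C
strategy⇒clearsIn n k [] {[]} _ _ _ = refl
strategy⇒clearsIn n k [] {x ∷ C} _ _ win = ⊥-elim (win x (here refl) tt)
strategy⇒clearsIn n k (S ∷ Ss) {C} ((|S|≤k , S⊆T) ∷ legal) C⊆T win =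
  inj₂ (lose (∈-listsUpTo⁺ k |S|≤k (All.map ∈-vertices⁺ S⊆T))
    (strategy⇒clearsIn n k Ss legal (All.tabulate (λ y∈ → proj₁ (∈-spread⁻ {n} {S} {C} y∈)))
      λ y y∈ ev → case ∈-spread⁻ {n} {S} {C} y∈ of λ where
        (y∈T , x , x∈C , x∉S , x~y) → win x x∈C (evades-∷ Ss x∉S x~y y∈T ev)))

hasWinningStrategy? : ∀ n k → Dec (HasWinningStrategy n k)
hasWinningStrategy? n k = map′
  (λ (t , cl) → clearable⇒winning (clear-⊆ (λ _ x∈T _ → ∈-vertices⁺ x∈T) (clearsIn⇒clearable n k t V⊆T cl)))
  (λ (Ss , legal , win) → length Ss ,
    strategy⇒clearsIn n k Ss legal V⊆T (λ x x∈V ev → win (x , ∈-vertices⁻ x∈V , ev)))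
  (eventually? (ClearsIn n k) (clearsIn? n k) (clearsIn-suc n k) (sublists (vertices n))
    stable-suc (self∈sublists (vertices n)))
  where
  V⊆T : All (InT n) (vertices n)
  V⊆T = All.tabulate ∈-vertices⁻
  -- A turn leads from a sublist to a sublist, so stability at `t` applies to the state reached.
  stable-suc : ∀ t → (∀ {C} → C ∈ sublists (vertices n) → ClearsIn n k (suc t) C → ClearsIn n k t C) →
    ∀ {C} → C ∈ sublists (vertices n) → ClearsIn n k (suc (suc t)) C → ClearsIn n k (suc t) C
  stable-suc t st _ (inj₁ C≡[]) = inj₁ C≡[]
  stable-suc t st {C} _ (inj₂ any) =
    inj₂ (Any.map (λ {S} → st (filter∈sublists (λ y → any? (reaches? C S y) C) (vertices n))) any)

-- Sweeping level by level.

-- A way to list T_n level by level such that neighbours in the next level have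
-- a position larger by at most drift.
record Sweep (n : ℕ) : Set where
  field
    level pos : Pt → ℕ
    point     : ℕ → ℕ → Pt
    width     : ℕ → ℕ
    drift     : ℕ
    point-of  : ∀ x → point (level x) (pos x) ≡ x
    pos<width : ∀ x → InT n x → pos x < width (level x)
    level-≤   : ∀ {x y} → StayOrMove x y → level x ≤ suc (level y)
    pos-≤     : ∀ {x y} → StayOrMove x y → level x ≡ suc (level y) → pos x ≤ pos y + drift

length-segment : ∀ (f : ℕ → Pt) m → length (map f (upTo m)) ≡ m
length-segment f m = trans (length-map f (upTo m)) (length-upTo m)

∈-segment : ∀ (f : ℕ → Pt) {m i x} → i < m → f i ≡ x → x ∈ map f (upTo m)
∈-segment f i<m refl = ∈-map⁺ f (∈-upTo⁺ i<m)

From : ∀ {n} → Sweep n → ℕ → ℕ → Pt → Set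
From W l j x = l < level x ⊎ (level x ≡ l × j ≤ pos x)
  where open Sweep W

module _ {n k : ℕ} (W : Sweep n) where
  open Sweep W

  -- Examine the rest of level `l` and the first `j + drift + 1` points of the next level. An
  -- intruder re-entering level `l` then comes from beyond position `j + drift` and lands beyond
  -- `j`. The size of the guard does not depend on `j`.
  sweep-point : ∀ {l j} → j < width l → suc (width l + drift) ≤ k →
    Clearable n k (From W l (suc j)) → Clearable n k (From W l j)
  sweep-point {l} {j} j<w w≤k = clear-step (here-on ++ next-up) size spreads
    where
    here-on = map (λ i → point l (j + i)) (upTo (width l ∸ j))
    next-up = map (point (suc l)) (upTo (suc (j + drift)))
    size : length (here-on ++ next-up) ≤ k
    size = begin
      length (here-on ++ next-up)          ≡⟨ length-++ here-on ⟩
      length here-on + length next-up      ≡⟨ cong₂ _+_ (length-segment _ (width l ∸ j)) (length-segment _ (suc (j + drift))) ⟩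
      width l ∸ j + suc (j + drift)        ≡⟨ +-suc (width l ∸ j) (j + drift) ⟩
      suc (width l ∸ j + (j + drift))      ≡⟨ cong suc (sym (+-assoc (width l ∸ j) j drift)) ⟩
      suc (width l ∸ j + j + drift)        ≡⟨ cong (λ m → suc (m + drift)) (m∸n+n≡m (<⇒≤ j<w)) ⟩
      suc (width l + drift)                ≤⟨ w≤k ⟩
      k                                    ∎
      where open ≤-Reasoning
    spreads : ∀ x y → InT n x → InT n y → From W l j x → x ∉ here-on ++ next-up → StayOrMove x y → From W l (suc j) y
    spreads x y x∈T _ (inj₂ (refl , j≤pos)) x∉S _ = ⊥-elim (x∉S (∈-++⁺ˡ
      (∈-segment _ (∸-monoˡ-< (pos<width x x∈T) j≤pos)
        (trans (cong (point (level x)) (m+[n∸m]≡n j≤pos)) (point-of x)))))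
    spreads x y _ _ (inj₁ l<lx) x∉S x~y with m≤n⇒m<n∨m≡n (≤-pred (≤-trans l<lx (level-≤ x~y)))
    ... | inj₁ l<ly = inj₁ l<ly
    ... | inj₂ refl = inj₂ (refl , ≰⇒> λ pos≤j → x∉S (∈-++⁺ʳ here-on
            (∈-segment _ (s≤s (≤-trans (pos-≤ x~y lx≡) (+-monoˡ-≤ drift pos≤j)))
              (trans (cong (λ m → point m (pos x)) (sym lx≡)) (point-of x)))))
      where
      lx≡ : level x ≡ suc (level y)
      lx≡ = ≤-antisym (level-≤ x~y) l<lx

  sweep-level : ∀ {l} → suc (width l + drift) ≤ k →
    Clearable n k (From W (suc l) 0) → Clearable n k (From W l 0)
  sweep-level {l} w≤k cl = go (width l) 0 (+-identityʳ (width l))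
    where
    go : ∀ d j → d + j ≡ width l → Clearable n k (From W l j)
    go zero j refl = clear-⊆ (λ where
      x _ (inj₁ l<lx) → [ inj₁ , (λ eq → inj₂ (sym eq , z≤n)) ]′ (m≤n⇒m<n∨m≡n l<lx)
      x x∈T (inj₂ (refl , w≤pos)) → ⊥-elim (<⇒≱ (pos<width x x∈T) w≤pos)) cl
    go (suc d) j eq = sweep-point (≤-trans (s≤s (m≤n+m j d)) (≤-reflexive eq)) w≤k
      (go d (suc j) (trans (+-suc d j) eq))

  sweep : ∀ {l} m → (∀ i → l ≤ i → i < m → suc (width i + drift) ≤ k) → l ≤ m →
    Clearable n k (From W m 0) → Clearable n k (From W l 0)
  sweep {l} m w≤k l≤m = go (≤⇒≤′ l≤m) w≤k
    where
    go : ∀ {m} → l ≤′ m → (∀ i → l ≤ i → i < m → suc (width i + drift) ≤ k) →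
      Clearable n k (From W m 0) → Clearable n k (From W l 0)
    go ≤′-refl _ cl = cl
    go (≤′-step {m} l≤m) w≤k cl =
      go l≤m (λ i l≤i i<m → w≤k i l≤i (m≤n⇒m≤1+n i<m)) (sweep-level (w≤k m (≤′⇒≤ l≤m) ≤-refl) cl)

abscissa-≤ : ∀ {x y} → StayOrMove x y → proj₁ x ≤ suc (proj₁ y)
abscissa-≤ (inj₁ refl) = n≤1+n _
abscissa-≤ (inj₂ (right a b)) = m≤n⇒m≤1+n (n≤1+n a)
abscissa-≤ (inj₂ (left a b)) = ≤-refl
abscissa-≤ (inj₂ (up a b)) = n≤1+n a
abscissa-≤ (inj₂ (down a b)) = n≤1+n a
abscissa-≤ (inj₂ (diagUL a b)) = ≤-refl
abscissa-≤ (inj₂ (diagDR a b)) = m≤n⇒m≤1+n (n≤1+n a)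

height : Pt → ℕ
height (a , b) = a + b

height-≤ : ∀ {x y} → StayOrMove x y → height x ≤ suc (height y)
height-≤ (inj₁ refl) = n≤1+n _
height-≤ (inj₂ (right a b)) = m≤n⇒m≤1+n (n≤1+n (a + b))
height-≤ (inj₂ (left a b)) = ≤-refl
height-≤ (inj₂ (up a b)) = m≤n⇒m≤1+n (+-monoʳ-≤ a (n≤1+n b))
height-≤ (inj₂ (down a b)) = ≤-reflexive (+-suc a b)
height-≤ (inj₂ (diagUL a b)) = s≤s (+-monoʳ-≤ a (n≤1+n b))
height-≤ (inj₂ (diagDR a b)) = ≤-trans (≤-reflexive (+-suc a b)) (n≤1+n _)

-- A vertex has its neighbours in the next column at its own ordinate or one less, hence drift 0.
columns : ∀ n → Sweep n
columns n = record
  { level = proj₁ ; pos = proj₂ ; point = _,_ ; width = suc n ∸_ ; drift = 0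
  ; point-of = λ _ → refl
  ; pos<width = λ (a , b) a+b≤n → ≤-trans (≤-reflexive (sym (m+n∸m≡n a (suc b))))
      (∸-monoˡ-≤ a (≤-trans (≤-reflexive (+-suc a b)) (s≤s a+b≤n)))
  ; level-≤ = abscissa-≤
  ; pos-≤ = λ where
      (inj₁ refl) eq → ⊥-elim (1+n≢n (sym eq))
      (inj₂ (right a b)) eq → ⊥-elim (<⇒≢ (m≤n⇒m≤1+n (n<1+n a)) eq)
      (inj₂ (left a b)) _ → ≤-reflexive (sym (+-identityʳ b))
      (inj₂ (up a b)) eq → ⊥-elim (1+n≢n (sym eq))
      (inj₂ (down a b)) eq → ⊥-elim (1+n≢n (sym eq))
      (inj₂ (diagUL a b)) _ → ≤-trans (n≤1+n b) (m≤m+n (suc b) 0)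
      (inj₂ (diagDR a b)) eq → ⊥-elim (<⇒≢ (m≤n⇒m≤1+n (n<1+n a)) eq)
  }

-- A vertex has its neighbours on the next diagonal at its own abscissa or one more, hence drift 1.
diagonals : ∀ n → Sweep n
diagonals n = record
  { level = height ; pos = proj₁ ; point = λ s i → i , s ∸ i ; width = suc ; drift = 1
  ; point-of = λ (a , b) → cong (a ,_) (m+n∸m≡n a b)
  ; pos<width = λ (a , b) _ → s≤s (m≤m+n a b)
  ; level-≤ = height-≤
  ; pos-≤ = λ {x} {y} x~y _ → ≤-trans (abscissa-≤ x~y) (≤-reflexive (sym (+-comm (proj₁ y) 1)))
  }

-- The exchange of the clean triangle for the left columns.

module _ {n h c : ℕ} (h+c≡n : h + c ≡ n) (3c≤h : 3 * c ≤ h) where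

  -- The contaminated region after t turns of the exchange.  The clean region is
  -- { a < c , a + b < h + t } ∪ { a + b < h , a + t ≤ 2 c }.
  Swap : ℕ → Pt → Set
  Swap t x = (c ≤ proj₁ x ⊎ h + t ≤ height x) × (h ≤ height x ⊎ 2 * c < proj₁ x + t)

  -- The right edge needs no guard: it retreats one column per turn, as fast as contamination can
  -- follow. Everything else that could reach the next clean region is examined, at a total of
  -- `3 * c + 2` points.
  swap-step : ∀ {t} → t ≤ c → Clearable n (h + 2) (Swap (suc t)) → Clearable n (h + 2) (Swap t)
  swap-step {t} t≤c = clear-step guard size spreads
    where
    -- On the left, the diagonal to be cleaned and the one beyond it; in column `c`, the wall
    -- between the old and new frontiers; right of it, the part of diagonal `h` still held.
    top₀ = map (λ a → a , h + t ∸ a) (upTo c)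
    top₁ = map (λ a → a , suc (h + t) ∸ a) (upTo c)
    side = map (λ i → c , h + i ∸ c) (upTo (t + 2))
    diag = map (λ i → suc c + i , h ∸ (suc c + i)) (upTo (c ∸ t))
    guard = top₀ ++ top₁ ++ side ++ diag

    size : length guard ≤ h + 2
    size = begin
      length guard
        ≡⟨ length-++ top₀ ⟩
      length top₀ + length (top₁ ++ side ++ diag)
        ≡⟨ cong (length top₀ +_) (trans (length-++ top₁) (cong (length top₁ +_) (length-++ side))) ⟩
      length top₀ + (length top₁ + (length side + length diag))
        ≡⟨ cong₂ _+_ (length-segment _ c) (cong₂ _+_ (length-segment _ c)
             (cong₂ _+_ (length-segment _ (t + 2)) (length-segment _ (c ∸ t)))) ⟩
      c + (c + (t + 2 + (c ∸ t)))
        ≡⟨ eq c t (c ∸ t) ⟩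
      2 * c + (t + (c ∸ t)) + 2
        ≡⟨ cong (λ m → 2 * c + m + 2) (m+[n∸m]≡n t≤c) ⟩
      2 * c + c + 2
        ≡⟨ cong (_+ 2) (+-comm (2 * c) c) ⟩
      3 * c + 2
        ≤⟨ +-monoˡ-≤ 2 3c≤h ⟩
      h + 2 ∎
      where
      open ≤-Reasoning
      eq : ∀ c t d → c + (c + (t + 2 + d)) ≡ 2 * c + (t + d) + 2
      eq = solve-∀

    on-top₀ : ∀ {a b} → a < c → a + b ≡ h + t → (a , b) ∈ guard
    on-top₀ {a} {b} a<c eq = ∈-++⁺ˡ (∈-segment _ a<c
      (cong (a ,_) (trans (cong (_∸ a) (sym eq)) (m+n∸m≡n a b))))
    on-top₁ : ∀ {a b} → a < c → a + b ≡ suc (h + t) → (a , b) ∈ guard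
    on-top₁ {a} {b} a<c eq = ∈-++⁺ʳ top₀ (∈-++⁺ˡ (∈-segment _ a<c
      (cong (a ,_) (trans (cong (_∸ a) (sym eq)) (m+n∸m≡n a b)))))
    on-side : ∀ {b} → h ≤ c + b → c + b ≤ suc (h + t) → (c , b) ∈ guard
    on-side {b} h≤ ≤1+h+t = ∈-++⁺ʳ top₀ (∈-++⁺ʳ top₁ (∈-++⁺ˡ (∈-segment _
      (≤-trans (s≤s (∸-monoˡ-≤ h ≤1+h+t)) (≤-reflexive (trans (cong (λ m → suc (m ∸ h)) (sym (+-suc h t)))
        (trans (cong suc (m+n∸m≡n h (suc t))) (+-comm 2 t)))))
      (cong (c ,_) (trans (cong (_∸ c) (m+[n∸m]≡n h≤)) (m+n∸m≡n c b))))))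
    on-diag : ∀ {a b} → c < a → a + t ≤ 2 * c → a + b ≡ h → (a , b) ∈ guard
    on-diag {a} {b} c<a a+t≤2c eq = ∈-++⁺ʳ top₀ (∈-++⁺ʳ top₁ (∈-++⁺ʳ side (∈-segment _
      {i = a ∸ suc c} (m+n≤o⇒m≤o∸n (suc (a ∸ suc c)) (+-cancelˡ-≤ c _ _ (begin
          c + (suc (a ∸ suc c) + t)  ≡⟨ sym (+-assoc c (suc (a ∸ suc c)) t) ⟩
          c + suc (a ∸ suc c) + t    ≡⟨ cong (_+ t) (trans (+-suc c (a ∸ suc c)) (m+[n∸m]≡n c<a)) ⟩
          a + t                      ≤⟨ a+t≤2c ⟩
          2 * c                      ≡⟨ cong (c +_) (+-identityʳ c) ⟩
          c + c                      ∎)))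
      (trans (cong (λ m → m , h ∸ m) (m+[n∸m]≡n c<a))
        (cong (a ,_) (trans (cong (_∸ a) (sym eq)) (m+n∸m≡n a b)))))))
      where open ≤-Reasoning

    spreads : ∀ x y → InT n x → InT n y → Swap t x → x ∉ guard → StayOrMove x y → Swap (suc t) y
    spreads (a , b) (a′ , b′) _ _ (left-or-high , high-or-right) x∉ x~y = first , second
      where
      high-if-left : a < c → h + t ≤ a + b
      high-if-left a<c = [ (λ c≤a → ⊥-elim (<⇒≱ a<c c≤a)) , id ]′ left-or-high
      high-if-near : a + t ≤ 2 * c → h ≤ a + b
      high-if-near near = [ id , (λ far → ⊥-elim (<⇒≱ far near)) ]′ high-or-right
      first : c ≤ a′ ⊎ h + suc t ≤ a′ + b′
      first with c ≤? a′ | h + suc t ≤? a′ + b′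
      ... | yes p | _ = inj₁ p
      ... | no _ | yes p = inj₂ p
      ... | no c≰a′ | no low = ⊥-elim (x∉ x∈)
        where
        a≤c : a ≤ c
        a≤c = ≤-trans (abscissa-≤ x~y) (≰⇒> c≰a′)
        s≤ : a + b ≤ suc (h + t)
        s≤ = ≤-trans (height-≤ x~y) (≤-trans (≰⇒> low) (≤-reflexive (+-suc h t)))
        x∈ : (a , b) ∈ guard
        x∈ with m≤n⇒m<n∨m≡n a≤c
        -- Because `t ≤ c`, column `c` has not been surrendered, so its contaminated points start at
        -- diagonal `h`.
        ... | inj₂ refl = on-side (high-if-near (≤-trans (+-monoʳ-≤ c t≤c)
                (≤-reflexive (cong (c +_) (sym (+-identityʳ c)))))) s≤
        ... | inj₁ a<c with m≤n⇒m<n∨m≡n (high-if-left a<c)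
        ...   | inj₁ lt = on-top₁ a<c (≤-antisym s≤ lt)
        ...   | inj₂ eq = on-top₀ a<c (sym eq)
      second : h ≤ a′ + b′ ⊎ 2 * c < a′ + suc t
      second with h ≤? a′ + b′ | 2 * c <? a′ + suc t
      ... | yes p | _ = inj₁ p
      ... | no _ | yes p = inj₂ p
      ... | no low | no near = ⊥-elim (x∉ x∈)
        where
        a+t≤2c : a + t ≤ 2 * c
        a+t≤2c = ≤-trans (+-monoˡ-≤ t (abscissa-≤ x~y)) (≤-trans (≤-reflexive (sym (+-suc a′ t))) (≮⇒≥ near))
        h≡ : a + b ≡ h
        h≡ = ≤-antisym (≤-trans (height-≤ x~y) (≰⇒> low)) (high-if-near a+t≤2c)
        x∈ : (a , b) ∈ guard
        x∈ with <-cmp a c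
        ... | tri≈ _ refl _ = on-side (≤-reflexive (sym h≡)) (≤-trans (≤-reflexive h≡) (m≤n⇒m≤1+n (m≤m+n h t)))
        ... | tri> _ _ c<a = on-diag c<a a+t≤2c h≡
        ... | tri< a<c _ _ = on-top₀ a<c
                (≤-antisym (≤-trans (≤-reflexive h≡) (m≤m+n h t)) (high-if-left a<c))

  swap : ∀ {t} d → d + t ≡ suc c → Clearable n (h + 2) (Swap (suc c)) → Clearable n (h + 2) (Swap t)
  swap zero refl cl = cl
  swap {t} (suc d) eq cl = swap-step (≤-pred (≤-trans (s≤s (m≤n+m t d)) (≤-reflexive eq)))
    (swap d (trans (+-suc d t) eq) cl)

  clear-triangle : Clearable n (h + 2) (λ _ → ⊤)
  clear-triangle =
    clear-⊆ {C′ = From (diagonals n) 0 0}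
      (λ (a , b) _ _ → case a + b ≟ 0 of λ where
        (yes eq) → inj₂ (eq , z≤n)
        (no neq) → inj₁ (n≢0⇒n>0 neq)) (
    -- Diagonal `i` has `i + 1` points and drift 1, so it takes `i + 3` searchers: `i < h` is the
    -- exact limit.
    sweep (diagonals n) h (λ i _ i<h → ≤-trans (≤-reflexive (cong (λ m → 2 + m) (+-comm i 1)))
        (≤-trans (s≤s (s≤s i<h)) (≤-reflexive (+-comm 2 h)))) z≤n (
    clear-⊆ {C′ = Swap 0}
      (λ (a , b) _ from → let h≤ : h ≤ a + b
                              h≤ = [ <⇒≤ , (λ (eq , _) → ≤-reflexive (sym eq)) ]′ from
                          in inj₂ (≤-trans (≤-reflexive (+-identityʳ h)) h≤) , inj₁ h≤) (
    swap (suc c) (+-identityʳ (suc c)) (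
    clear-⊆ {C′ = From (columns n) c 0}
      (λ (a , b) a+b≤n (low , _) → case low of λ where
        -- As `h + c = n`, the left frontier has now passed the hypotenuse.
        (inj₂ >n) → ⊥-elim (<⇒≱ (≤-trans (≤-reflexive (trans (cong suc (sym h+c≡n)) (sym (+-suc h c)))) >n) a+b≤n)
        (inj₁ c≤a) → [ inj₁ , (λ eq → inj₂ (sym eq , z≤n)) ]′ (m≤n⇒m<n∨m≡n c≤a)) (
    sweep (columns n) (suc n) column-size (m≤n⇒m≤1+n (≤-trans (m≤n+m c h) (≤-reflexive h+c≡n))) (
    clear-none λ (a , b) a+b≤n from → <⇒≱ ([ <⇒≤ , (λ (eq , _) → ≤-reflexive (sym eq)) ]′ from) (≤-trans (m≤m+n a b) a+b≤n)))))))
    where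
    column-size : ∀ i → c ≤ i → i < suc n → suc (suc n ∸ i + 0) ≤ h + 2
    column-size i c≤i i≤n = begin
      suc (suc n ∸ i + 0)   ≡⟨ cong suc (+-identityʳ _) ⟩
      suc (suc n ∸ i)       ≤⟨ s≤s (∸-monoʳ-≤ (suc n) c≤i) ⟩
      suc (suc n ∸ c)       ≡⟨ cong (λ m → suc (suc m ∸ c)) (sym h+c≡n) ⟩
      suc (suc h + c ∸ c)   ≡⟨ cong suc (m+n∸n≡m (suc h) c) ⟩
      2 + h                 ≡⟨ +-comm 2 h ⟩
      h + 2                 ∎
      where open ≤-Reasoning

upper-bound : ∀ n → HasWinningStrategy n (ceil3n/4 n + 2)
upper-bound n = clearable⇒winning (clear-triangle {c = n ∸ h} (m+[n∸m]≡n h≤n) 3c≤h)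
  where
  h = ceil3n/4 n
  h≤n : h ≤ n
  h≤n = ≤-pred (m<n*o⇒m/o<n (≤-by n (eq n)))
    where
    eq : ∀ n → suc n * 4 ≡ suc (3 * n + 3) + n
    eq = solve-∀
  3n≤4h : 3 * n ≤ 4 * h
  3n≤4h = +-cancelʳ-≤ 3 _ _ (begin
    3 * n + 3                  ≡⟨ m≡m%n+[m/n]*n (3 * n + 3) 4 ⟩
    (3 * n + 3) % 4 + h * 4    ≤⟨ +-mono-≤ (≤-pred (m%n<n (3 * n + 3) 4)) (≤-reflexive (*-comm h 4)) ⟩
    3 + 4 * h                  ≡⟨ +-comm 3 (4 * h) ⟩
    4 * h + 3                  ∎)
    where open ≤-Reasoning
  3c≤h : 3 * (n ∸ h) ≤ h
  3c≤h = begin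
    3 * (n ∸ h)          ≡⟨ *-distribˡ-∸ 3 n h ⟩
    3 * n ∸ 3 * h        ≤⟨ ∸-monoˡ-≤ (3 * h) 3n≤4h ⟩
    h + 3 * h ∸ 3 * h    ≡⟨ m+n∸n≡m h (3 * h) ⟩
    h                    ∎
    where open ≤-Reasoning

-- Neighbourhoods of 0-1 sequences on columns.

∑-indicator-≤ : ∀ L {f} → (∀ i → f i ≤ 1) → ∑ L f ≤ L
∑-indicator-≤ zero f≤1 = z≤n
∑-indicator-≤ (suc L) f≤1 = ≤-trans (+-mono-≤ (∑-indicator-≤ L f≤1) (f≤1 L)) (≤-reflexive (+-comm L 1))

0or1 : ∀ {p} → p ≤ 1 → p ≡ 0 ⊎ p ≡ 1
0or1 z≤n = inj₁ refl
0or1 (s≤s z≤n) = inj₂ refl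

module _ {f g : ℕ → ℕ} (f≤1 : ∀ i → f i ≤ 1) (g≤1 : ∀ i → g i ≤ 1) where

  -- A nonempty proper subset of a path has a neighbour outside. The induction splits off the last
  -- place and uses `fall` or `rise` where it differs from an empty or full remainder.
  spread-within : ∀ L → (∀ i → i < L → f i ≤ g i) →
    (∀ i → suc i < L → f i ≤ g (suc i)) → (∀ i → suc i < L → f (suc i) ≤ g i) →
    ∑ L f ≡ 0 ⊎ ∑ L f ≡ L ⊎ suc (∑ L f) ≤ ∑ L g
  spread-within zero _ _ _ = inj₁ refl
  spread-within (suc zero) _ _ _ = [ inj₁ , inj₂ ∘ inj₁ ]′ (0or1 (f≤1 0))
  spread-within (suc (suc L)) stay rise fall
    with spread-within (suc L) (λ i lt → stay i (m≤n⇒m≤1+n lt)) (λ i lt → rise i (m≤n⇒m≤1+n lt)) (λ i lt → fall i (m≤n⇒m≤1+n lt))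
       | 0or1 (f≤1 (suc L))
  ... | inj₁ none | inj₁ f≡0 = inj₁ (cong₂ _+_ none f≡0)
  ... | inj₁ none | inj₂ f≡1 = inj₂ (inj₂ (begin
    suc (∑ (suc L) f + f (suc L))   ≡⟨ cong suc (cong₂ _+_ none f≡1) ⟩
    1 + 1                           ≡⟨ sym (cong₂ _+_ f≡1 f≡1) ⟩
    f (suc L) + f (suc L)           ≤⟨ +-mono-≤ (≤-trans (fall L ≤-refl) (m≤n+m (g L) (∑ L g))) (stay (suc L) ≤-refl) ⟩
    ∑ (suc L) g + g (suc L)         ∎))
    where open ≤-Reasoning
  ... | inj₂ (inj₁ all) | inj₂ f≡1 = inj₂ (inj₁ (trans (cong₂ _+_ all f≡1) (+-comm (suc L) 1)))
  ... | inj₂ (inj₁ all) | inj₁ f≡0 = inj₂ (inj₂ (begin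
    suc (∑ (suc L) f + f (suc L))   ≡⟨ cong (λ p → suc (∑ (suc L) f + p)) f≡0 ⟩
    suc (∑ (suc L) f + 0)           ≡⟨ sym (+-suc (∑ (suc L) f) 0) ⟩
    ∑ (suc L) f + 1                 ≤⟨ +-mono-≤ (∑-mono (suc L) (λ i lt → stay i (m≤n⇒m≤1+n lt))) (≤-trans 1≤fL (rise L ≤-refl)) ⟩
    ∑ (suc L) g + g (suc L)         ∎))
    where
    open ≤-Reasoning
    1≤fL : 1 ≤ f L
    1≤fL = +-cancelˡ-≤ (∑ L f) 1 (f L) (begin
      ∑ L f + 1     ≤⟨ +-monoˡ-≤ 1 (∑-indicator-≤ L f≤1) ⟩
      L + 1         ≡⟨ +-comm L 1 ⟩
      suc L         ≡⟨ sym all ⟩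
      ∑ L f + f L   ∎)
  ... | inj₂ (inj₂ lt) | _ = inj₂ (inj₂ (+-mono-≤ lt (stay (suc L) ≤-refl)))

  -- At the first place where `g` vanishes, so does `f`. Earlier places of `f` match the same place
  -- of `g`; later ones match the place before by `fall`.
  spread-onward : ∀ L → (∀ i → i < L → f i ≤ g i) → (∀ i → i < L → f (suc i) ≤ g i) →
    ∑ L g ≡ L ⊎ ∑ (suc L) f ≤ ∑ L g
  spread-onward zero _ _ = inj₁ refl
  spread-onward (suc L) stay fall
    with spread-onward L (λ i lt → stay i (m≤n⇒m≤1+n lt)) (λ i lt → fall i (m≤n⇒m≤1+n lt))
       | 0or1 (g≤1 L)
  ... | inj₂ le | _ = inj₂ (+-mono-≤ le (fall L ≤-refl))
  ... | inj₁ all | inj₂ g≡1 = inj₁ (trans (cong₂ _+_ all g≡1) (+-comm L 1))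
  ... | inj₁ all | inj₁ g≡0 = inj₂ (+-mono-≤ (begin
    ∑ L f + f L    ≤⟨ +-mono-≤ (∑-indicator-≤ L f≤1) (≤-trans (stay L ≤-refl) (≤-reflexive g≡0)) ⟩
    L + 0          ≡⟨ +-identityʳ L ⟩
    L              ≡⟨ sym all ⟩
    ∑ L g          ∎) (fall L ≤-refl))
    where open ≤-Reasoning

  -- Match each occupied place of `f` with its successor in `g`; the first occupied place itself is
  -- left over in `g`.
  spread-back : ∀ L → (∀ i → i < L → f i ≤ g i) → (∀ i → i < L → f i ≤ g (suc i)) →
    ∑ L f ≡ 0 ⊎ suc (∑ L f) ≤ ∑ (suc L) g
  spread-back zero _ _ = inj₁ refl
  spread-back (suc L) stay rise
    with spread-back L (λ i lt → stay i (m≤n⇒m≤1+n lt)) (λ i lt → rise i (m≤n⇒m≤1+n lt))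
       | 0or1 (f≤1 L)
  ... | inj₂ lt | _ = inj₂ (+-mono-≤ lt (rise L ≤-refl))
  ... | inj₁ none | inj₁ f≡0 = inj₁ (cong₂ _+_ none f≡0)
  ... | inj₁ none | inj₂ f≡1 = inj₂ (begin
    suc (∑ L f + f L)               ≡⟨ cong suc (cong₂ _+_ none f≡1) ⟩
    1 + 1                           ≡⟨ sym (cong₂ _+_ f≡1 f≡1) ⟩
    f L + f L                       ≤⟨ +-mono-≤ (≤-trans (stay L ≤-refl) (m≤n+m (g L) (∑ L g))) (rise L ≤-refl) ⟩
    ∑ (suc L) g + g (suc L)         ∎)
    where open ≤-Reasoning

-- Counting vertices.

χ : List Pt → Pt → ℕ
χ C p = if does (p ∈? C) then 1 else 0

χ≤1 : ∀ C p → χ C p ≤ 1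
χ≤1 C p with does (p ∈? C)
... | true = ≤-refl
... | false = z≤n

χ-∈ : ∀ {C p} → p ∈ C → χ C p ≡ 1
χ-∈ {C} {p} p∈C with p ∈? C
... | yes _ = refl
... | no p∉C = ⊥-elim (p∉C p∈C)

χ-positive : ∀ {C p} → 0 < χ C p → p ∈ C
χ-positive {C} {p} pos with p ∈? C
... | yes p∈C = p∈C
χ-positive () | no _

χ-≤ : ∀ {C D p q} → (p ∈ C → q ∈ D) → χ C p ≤ χ D q
χ-≤ {C} {D} {p} {q} imp with p ∈? C
... | yes p∈C = ≤-reflexive (sym (χ-∈ (imp p∈C)))
... | no _ = z≤n

column : ℕ → List Pt → ℕ → ℕ
column n C a = ∑ (suc n ∸ a) (λ b → χ C (a , b))

-- Repetitions in the list and points outside the triangle do not count.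
card : ℕ → List Pt → ℕ
card n C = ∑ (suc n) (column n C)

in-column : ∀ {n a b} → b < suc n ∸ a → InT n (a , b)
in-column {n} {a} {b} lt = ≤-pred (≤-trans (≤-reflexive (cong suc (+-comm a b)))
  (m≤o∸n⇒m+n≤o (suc b) a≤1+n lt))
  where
  a≤1+n : a ≤ suc n
  a≤1+n = ≮⇒≥ λ 1+n<a → case subst (b <_) (m≤n⇒m∸n≡0 (<⇒≤ 1+n<a)) lt of λ ()

card-inhabited : ∀ {n C} → 1 ≤ card n C → ∃ λ x → InT n x × x ∈ C
card-inhabited {n} {C} pos
  with a , a<1+n , pos-a ← ∑-positive (suc n) (column n C) pos
  with b , b<L , pos-b ← ∑-positive (suc n ∸ a) (λ b → χ C (a , b)) pos-a =
  (a , b) , in-column b<L , χ-positive pos-b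

card-∪ : ∀ n C D E → (∀ p → χ C p ≤ χ D p + χ E p) → card n C ≤ card n D + card n E
card-∪ n C D E le = ≤-trans
  (∑-mono (suc n) λ a _ → ≤-trans (∑-mono (suc n ∸ a) λ b _ → le (a , b))
    (≤-reflexive (∑-+ (suc n ∸ a) (λ b → χ D (a , b)) (λ b → χ E (a , b)))))
  (≤-reflexive (∑-+ (suc n) (column n D) (column n E)))

card-≤-length : ∀ n S → card n S ≤ length S
card-≤-length n [] = ≤-trans (∑-mono (suc n) λ a _ → none (suc n ∸ a)) (none (suc n))
  where
  none : ∀ L → ∑ L (λ _ → 0) ≤ 0
  none zero = z≤n
  none (suc L) = ≤-trans (≤-reflexive (+-identityʳ _)) (none L)
card-≤-length n ((a₀ , b₀) ∷ S) = ≤-trans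
  (∑-single (suc n) a₀
    (λ a a≢ → ∑-mono (suc n ∸ a) λ b _ → drop λ where refl → a≢ refl)
    (∑-single (suc n ∸ a₀) b₀ (λ b b≢ → drop λ where refl → b≢ refl)
      (≤-trans (χ≤1 ((a₀ , b₀) ∷ S) (a₀ , b₀)) (s≤s z≤n))))
  (s≤s (card-≤-length n S))
  where
  drop : ∀ {p} → p ≢ (a₀ , b₀) → χ ((a₀ , b₀) ∷ S) p ≤ χ S p
  drop {p} p≢ = χ-≤ {(a₀ , b₀) ∷ S} {S} {p} λ where
    (here eq) → ⊥-elim (p≢ eq)
    (there p∈S) → p∈S

_∖_ : List Pt → List Pt → List Pt
C ∖ S = filter (λ x → ¬? (x ∈? S)) C

card-∖ : ∀ n C S → card n C ≤ card n (C ∖ S) + length S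
card-∖ n C S = ≤-trans (card-∪ n C (C ∖ S) S cover) (+-monoʳ-≤ (card n (C ∖ S)) (card-≤-length n S))
  where
  cover : ∀ p → χ C p ≤ χ (C ∖ S) p + χ S p
  cover p = case p ∈? S of λ where
    (yes p∈S) → ≤-trans (χ≤1 C p) (≤-trans (≤-reflexive (sym (χ-∈ {S} p∈S))) (m≤n+m (χ S p) (χ (C ∖ S) p)))
    (no p∉S) → ≤-trans (χ-≤ {C} {C ∖ S} {p} (λ p∈C → ∈-filter⁺ (λ x → ¬? (x ∈? S)) p∈C p∉S)) (m≤m+n (χ (C ∖ S) p) (χ S p))

-- `n * (n + 1) / 2`, written as a sum of column lengths so that `triangular (suc n)` is the vertex
-- count of the triangle `n`.
triangular : ℕ → ℕ
triangular n = ∑ n (n ∸_)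

triangular-double : ∀ n → 2 * triangular n ≡ n * suc n
triangular-double zero = refl
triangular-double (suc n) = begin
  2 * (∑ n (suc n ∸_) + (suc n ∸ n))
    ≡⟨ cong₂ (λ p q → 2 * (p + q)) (trans (∑-cong n (λ i i<n → +-∸-assoc 1 (<⇒≤ i<n))) (∑-+ n (λ _ → 1) (n ∸_)))
         (m+n∸n≡m 1 n) ⟩
  2 * (∑ n (λ _ → 1) + triangular n + 1)
    ≡⟨ cong (λ m → 2 * (m + triangular n + 1)) (ones n) ⟩
  2 * (n + triangular n + 1)
    ≡⟨ eq₁ n (triangular n) ⟩
  2 * triangular n + (2 * n + 2)
    ≡⟨ cong (_+ (2 * n + 2)) (triangular-double n) ⟩
  n * suc n + (2 * n + 2)
    ≡⟨ eq₂ n ⟩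
  suc n * suc (suc n) ∎
  where
  open ≡-Reasoning
  ones : ∀ n → ∑ n (λ _ → 1) ≡ n
  ones zero = refl
  ones (suc n) = trans (cong (_+ 1) (ones n)) (+-comm n 1)
  eq₁ : ∀ n t → 2 * (n + t + 1) ≡ 2 * t + (2 * n + 2)
  eq₁ = solve-∀
  eq₂ : ∀ n → n * suc n + (2 * n + 2) ≡ suc n * suc (suc n)
  eq₂ = solve-∀

-- From vertex sets to profiles.

module _ {n : ℕ} {B M : List Pt}
         (closed : ∀ {x y} → x ∈ B → InT n y → StayOrMove x y → y ∈ M) where

  spreads : ∀ {x y} → InT n y → StayOrMove x y → χ B x ≤ χ M y
  spreads {x} {y} y∈T x~y = χ-≤ {B} {M} {x} {y} (λ x∈B → closed x∈B y∈T x~y)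

  column-≤ : ∀ C a → column n C a ≤ suc n ∸ a
  column-≤ C a = ∑-indicator-≤ (suc n ∸ a) (λ b → χ≤1 C (a , b))

  column-mono : ∀ a → column n B a ≤ column n M a
  column-mono a = ∑-mono (suc n ∸ a) λ b b<L → spreads (in-column {n} {a} b<L) (inj₁ refl)

  column-split : ∀ a → column n B a + (suc n ∸ a ∸ column n B a) ≡ suc n ∸ a
  column-split a = m+[n∸m]≡n (column-≤ B a)

  -- The three spreading lemmas compare a column of `B` with the same, the next shorter and the next
  -- longer column of `M`.
  profile : Profile n
  profile = record
    { x = column n B
    ; z = λ a → suc n ∸ a ∸ column n B a
    ; c = λ a → column n M a ∸ column n B a
    ; last = trans (column-split n) (m+n∸n≡m 1 n)
    ; next = λ a a<n → trans (column-split a) (trans (+-∸-assoc 1 (<⇒≤ a<n)) (cong suc (sym (column-split (suc a)))))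
    ; c≤z = λ a _ → ∸-monoˡ-≤ (column n B a) (column-≤ M a)
    ; mixed = λ a _ → case spread-within (λ b → χ≤1 B (a , b)) (λ b → χ≤1 M (a , b)) (suc n ∸ a)
          (λ b lt → spreads (in-column {n} {a} lt) (inj₁ refl))
          (λ b lt → spreads (in-column {n} {a} lt) (inj₂ (up a b)))
          (λ b lt → spreads (in-column {n} {a} (<⇒≤ lt)) (inj₂ (down a b))) of λ where
        (inj₁ x≡0) → inj₁ x≡0
        (inj₂ (inj₁ x≡L)) → inj₂ (inj₁ (trans (cong (suc n ∸ a ∸_) x≡L) (n∸n≡0 (suc n ∸ a))))
        (inj₂ (inj₂ lt)) → inj₂ (inj₂ (m<n⇒0<n∸m lt))
    ; onward = λ a a<n → case spread-onward (λ b → χ≤1 B (a , b)) (λ b → χ≤1 M (suc a , b)) (n ∸ a)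
          (λ b lt → spreads (in-column {n} {suc a} lt) (inj₂ (right a b)))
          (λ b lt → spreads (in-column {n} {suc a} lt) (inj₂ (diagDR a b))) of λ where
        (inj₁ all) → inj₁ (∸-monoˡ-≤ (column n B (suc a)) (≤-reflexive (sym all)))
        (inj₂ le) → inj₂ (≤-trans (subst (λ L → ∑ L (λ b → χ B (a , b)) ≤ column n M (suc a)) (sym (+-∸-assoc 1 (<⇒≤ a<n))) le)
                       (≤-reflexive (sym (m+[n∸m]≡n (column-mono (suc a))))))
    ; back = λ a a<n → case spread-back (λ b → χ≤1 B (suc a , b)) (λ b → χ≤1 M (a , b)) (n ∸ a)
          (λ b lt → spreads (≤-trans (n≤1+n _) (in-column {n} {suc a} lt)) (inj₂ (left a b)))
          (λ b lt → spreads (≤-trans (≤-reflexive (+-suc a b)) (in-column {n} {suc a} lt)) (inj₂ (diagUL a b))) of λ where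
        (inj₁ x≡0) → inj₁ x≡0
        (inj₂ lt) → inj₂ (≤-trans (subst (λ L → suc (column n B (suc a)) ≤ ∑ L (λ b → χ M (a , b))) (sym (+-∸-assoc 1 (<⇒≤ a<n))) lt)
                       (≤-reflexive (sym (m+[n∸m]≡n (column-mono a)))))
    }

  -- The counts `x` and the deficits `z` add up to all `(n + 1) * (n + 2) / 2` vertices, which turns
  -- the bound on missing vertices into one on `B`.
  isoperimetry : ∃ λ F → card n M ≡ card n B + F ×
    (2 * card n B ≤ F * F ⊎ suc n * suc (suc n) ≤ 2 * card n B + F * suc F)
  isoperimetry = F , total , [ inj₁ , inj₂ ∘ complement ]′ (isoperimetry₁ profile)
    where
    open Profile profile
    F = ∑ (suc n) c
    total : card n M ≡ card n B + F
    total = trans (∑-cong (suc n) (λ a _ → sym (m+[n∸m]≡n (column-mono a)))) (∑-+ (suc n) x c)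
    complement : 2 * ∑ (suc n) z ≤ F * suc F → suc n * suc (suc n) ≤ 2 * card n B + F * suc F
    complement le = begin
      suc n * suc (suc n)                 ≡⟨ sym (triangular-double (suc n)) ⟩
      2 * ∑ (suc n) (suc n ∸_)            ≡⟨ cong (2 *_) (trans (∑-cong (suc n) (λ a _ → sym (column-split a))) (∑-+ (suc n) x z)) ⟩
      2 * (card n B + ∑ (suc n) z)        ≡⟨ *-distribˡ-+ 2 (card n B) (∑ (suc n) z) ⟩
      2 * card n B + 2 * ∑ (suc n) z      ≤⟨ +-monoʳ-≤ (2 * card n B) le ⟩
      2 * card n B + F * suc F            ∎
      where open ≤-Reasoning

-- Evasion of too few searchers.

module _ {n k : ℕ} (1≤n : 1 ≤ n) (2k²≤n² : 2 * (k * k) ≤ n * n) where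

  threshold : ℕ
  threshold = suc (triangular k)

  2threshold : 2 * threshold ≡ 2 + k * suc k
  2threshold = trans (*-distribˡ-+ 2 1 (triangular k)) (cong (2 +_) (triangular-double k))

  below-half : ∀ {F} j → F + j < k → F * F < 2 * (threshold + j)
  below-half {F} j F+j<k = begin-strict
    F * F                   ≤⟨ *-mono-≤ F≤k F≤k ⟩
    k * k                   ≤⟨ *-monoʳ-≤ k (n≤1+n k) ⟩
    k * suc k               <⟨ m≤n+m (suc (k * suc k)) 1 ⟩
    2 + k * suc k           ≡⟨ sym 2threshold ⟩
    2 * threshold           ≤⟨ *-monoʳ-≤ 2 (m≤m+n threshold j) ⟩
    2 * (threshold + j)     ∎
    where
    open ≤-Reasoning
    F≤k : F ≤ k
    F≤k = ≤-trans (m≤m+n F j) (<⇒≤ F+j<k)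

  -- Moving the surplus `j` into `F` only enlarges the left side. The worst case `F = k - 1`,
  -- `j = 0` gives `k (k + 1) + (k - 1) k = 2 k k`, at most `n * n`.
  above-half : ∀ {F} j → F + j < k → 2 * (threshold + j) + F * suc F < suc n * suc (suc n)
  above-half {F} j F+j<k = begin-strict
    2 * (threshold + j) + F * suc F           ≡⟨ cong (_+ F * suc F) (*-distribˡ-+ 2 threshold j) ⟩
    2 * threshold + 2 * j + F * suc F         ≡⟨ cong (λ t → t + 2 * j + F * suc F) 2threshold ⟩
    2 + k * suc k + 2 * j + F * suc F         ≤⟨ absorb j ⟩
    2 + k * suc k + (F + j) * suc (F + j)     ≤⟨ quadratic F+j<k ⟩
    2 + 2 * (k * k)                           ≤⟨ +-monoʳ-≤ 2 2k²≤n² ⟩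
    2 + n * n                                 <⟨ m<m+n (2 + n * n) (≤-trans 1≤n (m≤m+n n (n + (n + 0)))) ⟩
    2 + n * n + 3 * n                         ≡⟨ eq₁ n ⟩
    suc n * suc (suc n)                       ∎
    where
    open ≤-Reasoning
    eq₁ : ∀ n → 2 + n * n + 3 * n ≡ suc n * suc (suc n)
    eq₁ = solve-∀
    eq₂ : ∀ a F j → a + (F + suc j) * suc (F + suc j) ≡ a + 2 * suc j + F * suc F + (2 * (F * suc j) + j * suc j)
    eq₂ = solve-∀
    absorb : ∀ j → 2 + k * suc k + 2 * j + F * suc F ≤ 2 + k * suc k + (F + j) * suc (F + j)
    absorb zero rewrite +-identityʳ F | +-identityʳ (k * suc k) = ≤-refl
    absorb (suc j) = ≤-by _ (eq₂ (2 + k * suc k) F j)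
    eq₃ : ∀ k → 2 + suc k * suc (suc k) + k * suc k ≡ 2 + 2 * (suc k * suc k)
    eq₃ = solve-∀
    quadratic : ∀ {k G} → G < k → 2 + k * suc k + G * suc G ≤ 2 + 2 * (k * k)
    quadratic {suc k} (s≤s G≤k) = ≤-trans (+-monoʳ-≤ (2 + suc k * suc (suc k)) (*-mono-≤ G≤k (s≤s G≤k))) (≤-reflexive (eq₃ k))

  growth : ∀ {B M} → (∀ {x y} → x ∈ B → InT n y → StayOrMove x y → y ∈ M) →
    threshold ≤ card n B → threshold + k ≤ card n M
  growth {B} {M} closed t≤B with F , total , half ← isoperimetry {n} {B} {M} closed = ≮⇒≥ λ small →
    -- `j` is the surplus of `B` over `threshold`; insufficient growth means `F + j < k`,
    -- contradicting both alternatives.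
    let j = card n B ∸ threshold
        B≡ : card n B ≡ threshold + j
        B≡ = sym (m+[n∸m]≡n t≤B)
        F+j<k : F + j < k
        F+j<k = +-cancelˡ-< threshold (F + j) k (subst (_< threshold + k)
          (trans total (trans (cong (_+ F) B≡) (trans (+-assoc threshold j F) (cong (threshold +_) (+-comm j F))))) small)
    in case half of λ where
      (inj₁ le) → <⇒≱ (below-half j F+j<k) (subst (λ b → 2 * b ≤ F * F) B≡ le)
      (inj₂ le) → <⇒≱ (above-half j F+j<k) (subst (λ b → suc n * suc (suc n) ≤ 2 * b + F * suc F) B≡ le)

  -- An examination removes at most `k` positions and `growth` restores the bound. The walk is built
  -- from its end: a survivor of the remaining turns is traced back to a predecessor in `C`.
  evader : ∀ Ss {C} → All (Legal n k) Ss → All (InT n) C → threshold + k ≤ card n C →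
    ∃ λ x → x ∈ C × Evades n x Ss
  evader [] _ _ large with x , _ , x∈C ← card-inhabited {n} (≤-trans (s≤s z≤n) large) = x , x∈C , _
  evader (S ∷ Ss) {C} ((|S|≤k , _) ∷ legal) C⊆T large
    with y , y∈ , ev ← evader Ss {spread n S C} legal (All.tabulate λ y∈ → proj₁ (∈-spread⁻ {n} {S} {C} y∈))
           (growth {C ∖ S} {spread n S C}
             (λ x∈ y∈T x~y → case ∈-filter⁻ (λ x → ¬? (x ∈? S)) {xs = C} x∈ of λ where
               (x∈C , x∉S) → ∈-spread⁺ x∈C x∉S x~y y∈T)
             (+-cancelʳ-≤ k threshold (card n (C ∖ S))
               (≤-trans large (≤-trans (card-∖ n C S) (+-monoʳ-≤ (card n (C ∖ S)) |S|≤k)))))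
    with y∈T , x , x∈C , x∉S , x~y ← ∈-spread⁻ {n} {S} {C} y∈ = x , x∈C , evades-∷ Ss x∉S x~y y∈T ev

  k≤n : k ≤ n
  k≤n = ≮⇒≥ λ n<k → <⇒≱ (*-mono-< n<k n<k) (≤-trans (m≤m+n (k * k) _) 2k²≤n²)

  -- `threshold + k` is the number of vertices of the triangle `k`, and `k ≤ n`.
  vertices-large : threshold + k ≤ card n (vertices n)
  vertices-large = *-cancelˡ-≤ 2 (begin
    2 * (threshold + k)             ≡⟨ *-distribˡ-+ 2 threshold k ⟩
    2 * threshold + 2 * k           ≡⟨ cong (_+ 2 * k) 2threshold ⟩
    2 + k * suc k + 2 * k           ≡⟨ eq k ⟩
    suc k * suc (suc k)             ≤⟨ *-mono-≤ (s≤s k≤n) (s≤s (s≤s k≤n)) ⟩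
    suc n * suc (suc n)             ≡⟨ sym (triangular-double (suc n)) ⟩
    2 * ∑ (suc n) (suc n ∸_)        ≤⟨ *-monoʳ-≤ 2 (∑-mono (suc n) λ a _ → full a (suc n ∸ a) λ b → in-column {n} {a} {b}) ⟩
    2 * card n (vertices n)         ∎)
    where
    open ≤-Reasoning
    eq : ∀ k → 2 + k * suc k + 2 * k ≡ suc k * suc (suc k)
    eq = solve-∀
    full : ∀ a L → (∀ b → b < L → InT n (a , b)) → L ≤ ∑ L (λ b → χ (vertices n) (a , b))
    full a zero _ = z≤n
    full a (suc L) ⊆T = ≤-trans (≤-reflexive (+-comm 1 L))
      (+-mono-≤ (full a L (λ b b<L → ⊆T b (m≤n⇒m≤1+n b<L))) (≤-reflexive (sym (χ-∈ (∈-vertices⁺ (⊆T L ≤-refl))))))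

  lower-bound : ¬ HasWinningStrategy n k
  lower-bound (Ss , legal , win)
    with x , x∈V , ev ← evader Ss legal (All.tabulate (∈-vertices⁻ {n})) vertices-large =
    win (x , ∈-vertices⁻ x∈V , ev)

-- The lower bound is squared to avoid the square root of 2.
theorem2 : (n : ℕ) → 1 ≤ n →
    ∃ λ k → IsInspectionNumber n k × (n * n < 2 * (k * k)) × k ≤ ceil3n/4 n + 2
theorem2 n 1≤n with least (hasWinningStrategy? n) (suc (ceil3n/4 n + 2))
-- The search range includes the number from `upper-bound`, so the search cannot fail.
... | inj₂ none = ⊥-elim (none _ ≤-refl (upper-bound n))
... | inj₁ (k , winning , minimal) =
  k , (winning , minimal) , ≰⇒> (λ 2k²≤n² → lower-bound 1≤n 2k²≤n² winning) , minimal _ (upper-bound n)
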